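{- Let $T=(\vec G,G,\prec,A)$ be a twisted graph, simplicial on $F$, with edge set $E=F\sqcup\{x_1,x_2,x_3\}$ where $x_1\prec x_2\prec x_3$, and let $C$ be either $(\{x_1,x_3\},\{x_2\})$ or its opposite $(\{x_2\},\{x_1,x_3\})$. Fix orderings of the rows and columns of $\Sigma(T)$. Then there is a sign $\sigma_C\in\{1,-1\}$ such that, for every $\boldsymbol\theta$ respecting $\prec$, the system of strict inequalities $\widehat a\cdot\mathbf r>0$ ($a\in A$) together with $\widehat C\cdot\mathbf r>0$, in the unknown $\mathbf r\in\mathbb{R}^E$, is soluble if and only if the sign of the determinant of the square submatrix of $\Sigma(T)$ on the columns $F\cup\{x_1\}$ equals $\sigma_C$. Moreover $\sigma_{ -C}=-\sigma_C$.
   Context: Signed sets on a finite set $E$: pairs $X=(X^+,X^-)$ of disjoint subsets, $X(e)=+1,-1,0$ according as $e\in X^+$, $e\in X^-$, or neither; support $\underline X=X^+\cup X^-$; $-X=(X^-,X^+)$. Conformal: no $e$ with $X(e)=-Y(e)\ne0$; composition $(X\circ Y)(e)=X(e)$ if $X(e)\ne0$, else $Y(e)$. For a total order $<$ on $E$, $\mathcal C(<)=\{(\{e_1,e_3\},\{e_2\}),(\{e_2\},\{e_1,e_3\}):e_1<e_2<e_3\}$ (circuits of the rank 2 oriented matroid $\mathcal M(<)$; vectors are compositions of pairwise conformal families of circuits); for a partial order $\prec$, $\mathcal C(\prec)=\bigcap_{<\supseteq\prec}\mathcal C(<)$. For a directed graph $\vec G=(V,\vec E)$ (no loops, parallel or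 antiparallel edges), underlying simple graph $G=(V,E)$, a strong map $\mathcal M^*(\vec G)\to\mathcal M(<)$ means every signed minimal cut $(\{(u,w):u\in S,w\notin S\},\{(u,w):w\in S,u\notin S\})$ ($S$, $V\setminus S$ inducing connected subgraphs) is a vector of $\mathcal M(<)$; $C^*_v=(\{(u,v)\in\vec E\},\{(v,u)\in\vec E\})$. A twisted graph $T=(\vec G,G,\prec,A)$: $\prec$ a partial order on $E$, $G$ three-edge-connected, $A\subset\mathcal C(\prec)$, a strong map $\mathcal M^*(\vec G)\to\mathcal M(<)$ for every total $<\supseteq\prec$, and a partition $A=\bigsqcup_v A_v$ with members of $A_v$ pairwise conformal and composing to $C^*_v$. $\boldsymbol\theta\in\mathbb{R}^E$ respects $\prec$ if $0<\theta_e<180$ (degrees) and $\theta_e<\theta_f$ whenever $e\prec f$. For a signed set $c$ with $|\underline c|=3$ whose support elements needed below are $\prec$-comparable, $\widehat c\in\mathbb{R}^E$ has $\widehat c(e)=0$ for $e\notin\underline c$ and $\widehat c(e)=c(e)\sin(\theta_{e''}-\theta_{e'})$ if $\underline c=\{e,e',e''\}$ with $e'\prec e''$; $\Sigma(T)$ is the $|A|\times|E|$ matrix with rows $\widehat a$, $a\in A$. A matrix with $r+1$ rows and $r$ columns is a simplex if its rows have a linear dependency with all coefficients positive and every row dependency is a multiple of it. $T$ is simplicial on $F$ if for every $\boldsymbol\theta$ respecting $\prec$ the submatrix of $\Sigma(T)$ on columns $F$ is a simplex (so $|F|=|A|-1$ and the submatrix on $F\cup\{x_1\}$ is square). -}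

module Defs where

open import Algebra.Bundles using (CommutativeRing; Semiring)
open import Data.Fin.Base using (Fin; zero; suc; toℕ; punchIn)
open import Data.Fin.Properties using (_≟_; any?)
open import Data.Fin.Subset using (Subset; _∈_; _∉_; ∁; _∪_; ⁅_⁆; ∣_∣; Nonempty)
open import Data.List.Base as List using (List; foldr; allFin; filter)
open import Data.List.Relation.Unary.All using (All)
open import Data.List.Relation.Unary.AllPairs using (AllPairs)
open import Data.Maybe.Base as Maybe using (Maybe; just; nothing; is-just; _<∣>_)
open import Data.Nat.Base as ℕ using (ℕ; zero; suc)
open import Data.Product.Base using (Σ; Σ-syntax; ∃; ∃-syntax; ∃₂; _×_; _,_)
open import Data.Sign.Base as Sign using (Sign; opposite)
open import Data.Sum.Base using (_⊎_)
open import Data.Vec.Base as Vec using (Vec; lookup)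
open import Data.Vec.Properties using (≡-dec)
import Data.Bool.Properties as Bool
open import Function.Bundles using (_⇔_)
open import Function.Definitions using (Injective)
open import Level using (Level; _⊔_; 0ℓ) renaming (suc to lsuc)
open import Relation.Binary.Construct.Closure.Equivalence using (EqClosure)
open import Relation.Binary.Core using (Rel; _⇒_)
open import Relation.Binary.PropositionalEquality using (_≡_; _≢_)
open import Relation.Binary.Structures using (IsStrictTotalOrder; IsDecStrictPartialOrder)
open import Relation.Nullary using (¬_; Dec; yes; no; _×-dec_)
open import Relation.Unary using (Pred)
import Algebra.Definitions.RawSemiring as RawSemiringDefs

------------------------------------------------------------------------
-- Real numbers

-- A Dedekind-complete ordered field.  Classically ℝ is, up to isomorphism,
-- the only one.
record Reals (c ℓ₁ ℓ₂ : Level) : Set (lsuc (c ⊔ ℓ₁ ⊔ ℓ₂)) where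
  infix 4 _<_
  field
    commutativeRing : CommutativeRing c ℓ₁
  open CommutativeRing commutativeRing public
  field
    _<_                : Rel Carrier ℓ₂
    isStrictTotalOrder : IsStrictTotalOrder _≈_ _<_
    0<1                : 0# < 1#
    +-monoˡ-<          : ∀ {x y} z → x < y → (x + z) < (y + z)
    *-pos              : ∀ {x y} → 0# < x → 0# < y → 0# < (x * y)
    inverse            : ∀ x → ¬ (x ≈ 0#) → ∃[ y ] ((x * y) ≈ 1#)

  UpperBound : Pred Carrier (c ⊔ ℓ₁ ⊔ ℓ₂) → Carrier → Set (c ⊔ ℓ₁ ⊔ ℓ₂)
  UpperBound P b = ∀ {x} → P x → ¬ (b < x)

  field
    supremum : (P : Pred Carrier (c ⊔ ℓ₁ ⊔ ℓ₂)) → ∃ P → ∃ (UpperBound P) →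
               ∃[ s ] (UpperBound P s × (∀ b → UpperBound P b → ¬ (b < s)))

  open RawSemiringDefs (Semiring.rawSemiring semiring) public
    using (sum; _^_) renaming (_×_ to _·_)

-- Sine and cosine of an angle in degrees: t ↦ (cos t , sin t) is a
-- homomorphism from the additive group of ℝ to the unit circle for which
-- 180 is the first positive zero of sin, and sin is positive before it.
-- These laws determine both functions: cos is strictly decreasing on
-- [0,180], and the half-angle formulas, with the signs forced by sin-pos,
-- give the values at the dyadic multiples of 180.
record Trigonometry {c ℓ₁ ℓ₂} (ℝ : Reals c ℓ₁ ℓ₂) : Set (c ⊔ ℓ₁ ⊔ ℓ₂) where
  open Reals ℝ hiding (zero)
  field
    sin cos      : Carrier → Carrier
    sin-cong     : ∀ {x y} → x ≈ y → sin x ≈ sin y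
    cos-cong     : ∀ {x y} → x ≈ y → cos x ≈ cos y
    sin-+        : ∀ x y → sin (x + y) ≈ ((sin x * cos y) + (cos x * sin y))
    cos-+        : ∀ x y → cos (x + y) ≈ ((cos x * cos y) - (sin x * sin y))
    cos²+sin²≈1  : ∀ x → ((cos x * cos x) + (sin x * sin x)) ≈ 1#
    sin-pos      : ∀ x → 0# < x → x < (180 · 1#) → 0# < sin x
    sin-180      : sin (180 · 1#) ≈ 0#

------------------------------------------------------------------------
-- Signed sets

-- X is encoded by the vector of its values X(e), with  nothing  for 0.
SignedSet : ℕ → Set
SignedSet m = Vec (Maybe Sign) m

module _ {m : ℕ} where

  -- X = (P , N)
  infix 4 _≗⟨_,_⟩
  _≗⟨_,_⟩ : SignedSet m → (P N : Pred (Fin m) 0ℓ) → Set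
  X ≗⟨ P , N ⟩ = ∀ e → (lookup X e ≡ just Sign.+ ⇔ P e) ×
                       (lookup X e ≡ just Sign.- ⇔ N e)

  support : SignedSet m → Subset m
  support = Vec.map is-just

  infix 8 -ˢ_
  -ˢ_ : SignedSet m → SignedSet m
  -ˢ_ = Vec.map (Maybe.map opposite)

  Conformal : SignedSet m → SignedSet m → Set
  Conformal X Y =
    ¬ (∃₂ λ e s → lookup X e ≡ just s × lookup Y e ≡ just (opposite s))

  infixr 6 _∘ˢ_
  _∘ˢ_ : SignedSet m → SignedSet m → SignedSet m
  _∘ˢ_ = Vec.zipWith _<∣>_

  compose : List (SignedSet m) → SignedSet m
  compose = foldr _∘ˢ_ (Vec.replicate m nothing)

  -- X is ({e₁,e₃},{e₂}) or its opposite.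
  Alternating : (e₁ e₂ e₃ : Fin m) → SignedSet m → Set
  Alternating e₁ e₂ e₃ X =
    X ≗⟨ (λ e → e ≡ e₁ ⊎ e ≡ e₃) , (λ e → e ≡ e₂) ⟩ ⊎
    X ≗⟨ (λ e → e ≡ e₂) , (λ e → e ≡ e₁ ⊎ e ≡ e₃) ⟩

  -- Circuits and vectors of 𝓜(<).
  IsCircuit : Rel (Fin m) 0ℓ → SignedSet m → Set
  IsCircuit _<_ X =
    ∃[ e₁ ] ∃[ e₂ ] ∃[ e₃ ] (e₁ < e₂ × e₂ < e₃ × Alternating e₁ e₂ e₃ X)

  IsVector : Rel (Fin m) 0ℓ → SignedSet m → Set
  IsVector _<_ X =
    ∃[ cs ] (All (IsCircuit _<_) cs × AllPairs Conformal cs × X ≡ compose cs)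

  record LinearExtension (_≺_ _<_ : Rel (Fin m) 0ℓ) : Set where
    field
      isStrictTotalOrder : IsStrictTotalOrder _≡_ _<_
      extends            : _≺_ ⇒ _<_

------------------------------------------------------------------------
-- Directed graphs

-- The edge e is the arc (tail e , head e).
record DirectedGraph (n m : ℕ) : Set where
  field
    tail head      : Fin m → Fin n
    noLoops        : ∀ e → tail e ≢ head e
    noParallel     : ∀ e f → tail e ≡ tail f → head e ≡ head f → e ≡ f
    noAntiparallel : ∀ e f → ¬ (tail e ≡ head f × head e ≡ tail f)

  -- G with the edges in D deleted is connected.
  ConnectedWithout : Subset m → Set
  ConnectedWithout D =
    ∀ u w → EqClosure (λ x y → ∃[ e ] (e ∉ D × tail e ≡ x × head e ≡ y)) u w

  ThreeEdgeConnected : Set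
  ThreeEdgeConnected = ∀ D → ∣ D ∣ ℕ.< 3 → ConnectedWithout D

  -- The subgraph of G induced on S is connected.
  InducedConnected : Subset n → Set
  InducedConnected S = Nonempty S × (∀ u w → u ∈ S → w ∈ S →
    EqClosure (λ x y → x ∈ S × y ∈ S × ∃[ e ] (tail e ≡ x × head e ≡ y)) u w)

  IsMinimalCut : SignedSet m → Set
  IsMinimalCut X = ∃[ S ] (InducedConnected S × InducedConnected (∁ S) ×
    X ≗⟨ (λ e → tail e ∈ S × head e ∉ S) , (λ e → head e ∈ S × tail e ∉ S) ⟩)

  IsVertexCut : Fin n → SignedSet m → Set
  IsVertexCut v X = X ≗⟨ (λ e → head e ≡ v) , (λ e → tail e ≡ v) ⟩

  -- A strong map 𝓜*(G) → 𝓜(<).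
  StrongMap : Rel (Fin m) 0ℓ → Set
  StrongMap _<_ = ∀ X → IsMinimalCut X → IsVector _<_ X

------------------------------------------------------------------------
-- Twisted graphs

-- The edge set is Fin m.  The set A is listed without repetition by
-- a : Fin p → SignedSet m, which is also the ordering of the rows of Σ(T);
-- a i belongs to the part A_v with v = vertex i.
record TwistedGraph (n m p : ℕ) : Set₁ where
  infix 4 _≺_
  field
    graph                   : DirectedGraph n m
    _≺_                     : Rel (Fin m) 0ℓ
    isDecStrictPartialOrder : IsDecStrictPartialOrder _≡_ _≺_
    a                       : Fin p → SignedSet m
    a-injective             : Injective _≡_ _≡_ a
    vertex                  : Fin p → Fin n

  open DirectedGraph graph public
  open IsDecStrictPartialOrder isDecStrictPartialOrder public
    using () renaming (_<?_ to _≺?_)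

  part : Fin n → List (SignedSet m)
  part v = List.map a (filter (λ i → vertex i ≟ v) (allFin p))

  field
    threeEdgeConnected : ThreeEdgeConnected
    A⊆𝒞≺               : ∀ i _<_ → LinearExtension _≺_ _<_ → IsCircuit _<_ (a i)
    strongMap          : ∀ _<_ → LinearExtension _≺_ _<_ → StrongMap _<_
    part-conformal     : ∀ v → AllPairs Conformal (part v)
    part-compose       : ∀ v → IsVertexCut v (compose (part v))

Enumerates : ∀ {k m} → (Fin k → Fin m) → Subset m → Set
Enumerates f S = Injective _≡_ _≡_ f × (∀ e → e ∈ S ⇔ (∃[ j ] f j ≡ e))

------------------------------------------------------------------------
-- Matrices

module Linear {c ℓ₁ ℓ₂} (ℝ : Reals c ℓ₁ ℓ₂) where
  open Reals ℝ hiding (zero)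

  Matrix : ℕ → ℕ → Set c
  Matrix p q = Fin p → Fin q → Carrier

  dot : ∀ {m} → (Fin m → Carrier) → (Fin m → Carrier) → Carrier
  dot u v = sum (λ e → u e * v e)

  -- Laplace expansion along the first row.
  det : ∀ {k} → Matrix k k → Carrier
  det {zero}  M = 1#
  det {suc k} M = sum λ j →
    ((- 1#) ^ toℕ j) * (M zero j * det (λ i l → M (suc i) (punchIn j l)))

  RowDependency : ∀ {p q} → Matrix p q → (Fin p → Carrier) → Set ℓ₁
  RowDependency M μ = ∀ j → sum (λ i → μ i * M i j) ≈ 0#

  IsSimplex : ∀ {p q} → Matrix p q → Set (c ⊔ ℓ₁ ⊔ ℓ₂)
  IsSimplex {p} {q} M = p ≡ suc q ×
    Σ[ μ ∈ (Fin p → Carrier) ] ((∀ i → 0# < μ i) × RowDependency M μ ×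
      (∀ ν → RowDependency M ν → ∃[ t ] (∀ i → ν i ≈ (t * μ i))))

  HasSign : Carrier → Sign → Set ℓ₂
  HasSign x Sign.+ = 0# < x
  HasSign x Sign.- = x < 0#

------------------------------------------------------------------------
-- The matrix Σ(T)

module Twisted {c ℓ₁ ℓ₂} {ℝ : Reals c ℓ₁ ℓ₂} (trig : Trigonometry ℝ)
               {n m p : ℕ} (T : TwistedGraph n m p) where
  open Reals ℝ hiding (zero)
  open Trigonometry trig
  open TwistedGraph T
  open Linear ℝ

  Respects : (Fin m → Carrier) → Set ℓ₂
  Respects θ = (∀ e → 0# < θ e × θ e < (180 · 1#)) ×
               (∀ e f → e ≺ f → θ e < θ f)

  value : Maybe Sign → Carrier
  value (just Sign.+) = 1#
  value (just Sign.-) = - 1#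
  value nothing       = 0#

  -- The support of X is {e,e′,e″} with e′ ≺ e″.  For a support of size three
  -- there is at most one such pair (e′,e″).
  OtherTwo : SignedSet m → (e e′ e″ : Fin m) → Set
  OtherTwo X e e′ e″ = support X ≡ ⁅ e ⁆ ∪ (⁅ e′ ⁆ ∪ ⁅ e″ ⁆) × e′ ≺ e″

  otherTwo? : ∀ X e → Dec (∃₂ (OtherTwo X e))
  otherTwo? X e = any? λ e′ → any? λ e″ →
    ≡-dec Bool._≟_ (support X) (⁅ e ⁆ ∪ (⁅ e′ ⁆ ∪ ⁅ e″ ⁆)) ×-dec (e′ ≺? e″)

  hat : (Fin m → Carrier) → SignedSet m → Fin m → Carrier
  hat θ X e with otherTwo? X e
  ... | yes (e′ , e″ , _) = value (lookup X e) * sin (θ e″ - θ e′)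
  ... | no  _             = 0#

  ΣT : (Fin m → Carrier) → Matrix p m
  ΣT θ i = hat θ (a i)

  columns : ∀ {p q} → Matrix p m → (Fin q → Fin m) → Matrix p q
  columns M f i j = M i (f j)

  SimplicialOn : Subset m → Set (c ⊔ ℓ₁ ⊔ ℓ₂)
  SimplicialOn F = ∃[ q ] Σ[ f ∈ (Fin q → Fin m) ] (Enumerates f F ×
    (∀ θ → Respects θ → IsSimplex (columns (ΣT θ) f)))

  Soluble : (Fin m → Carrier) → SignedSet m → Set (c ⊔ ℓ₂)
  Soluble θ C = Σ[ r ∈ (Fin m → Carrier) ]
    ((∀ i → 0# < dot (ΣT θ i) r) × 0# < dot (hat θ C) r)

{-# OPTIONS --safe #-}

-- Let μ > 0 be the row dependency of the simplex on F and w = Σᵢ μᵢ âᵢ.  It is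
-- supported on {x₁,x₂,x₃}, and like every âᵢ it is orthogonal to cos θ and sin θ
-- (each â is the linear dependency of three points of the unit circle); so w is a
-- multiple s Ĉ of Ĉ.  A solution r gives s (Ĉ · r) = Σᵢ μᵢ (âᵢ · r) > 0, hence
-- s > 0; conversely, if s > 0 then M, the columns F ∪ {x₁} of Σ(T), is invertible,
-- and the r with M r = (1,…,1) and r(x₂) = r(x₃) = 0 is a solution.  Replacing the
-- first row of M by the combination with coefficients μ gives μ₀ det M = ± w(x₁) m₀,
-- where m₀ is a maximal minor of the columns F.  As the columns F always form a
-- simplex, m₀ has no zero; being continuous, it has constant sign on the convex set
-- of all θ respecting ≺, and the sign of det M is that of s up to this constant.
-- Continuity of sin at 0 holds because halving an acute angle more than halves sin².

module Submission where

open import Defs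
open import Algebra.Bundles using (RawRing)
open import Algebra.Solver.Ring.AlmostCommutativeRing using (fromCommutativeRing; _-Raw-AlmostCommutative⟶_)
import Algebra.Solver.Ring as RingSolver
open import Data.Bool.Base using (if_then_else_)
open import Data.Empty using (⊥; ⊥-elim)
open import Data.Fin.Base as Fin using (Fin; zero; suc; toℕ; punchIn; punchOut) renaming (lift to liftFin)
open import Data.Fin.Properties as Fin using (_≟_; any?; punchInᵢ≢i; punchIn-punchOut)
open import Data.Fin.Subset using (Subset; ∁; _∪_; ⁅_⁆; ∣_∣; _∈_; _∉_)
open import Data.Fin.Subset.Properties using (⊆-antisym; _∈?_; p⊂q⇒∣p∣<∣q∣; ∣p∣≤n; x∈p∪q⁺; x∈p∪q⁻; x∈⁅x⁆; x∈⁅y⁆⇒x≡y; x∉∁p⇒x∈p; x∈p⇒x∉∁p)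
open import Data.Maybe.Base as Maybe using (Maybe; just; nothing; is-just; fromMaybe)
open import Data.Maybe.Properties using (just-injective)
open import Data.Nat.Base as ℕ using (ℕ; zero; suc; s≤s)
import Data.Nat.Properties as ℕ
open import Data.Product.Base using (∃; ∃-syntax; Σ-syntax; _×_; _,_; proj₁; proj₂; uncurry)
open import Data.Sign.Base as Sign using (Sign; opposite)
open import Data.Sum.Base using (_⊎_; inj₁; inj₂; [_,_]′)
open import Data.Vec.Base as Vec using (lookup)
open import Data.Vec.Functional using (Vector; _∷_; removeAt; insertAt)
open import Data.Vec.Functional.Properties using (insertAt-lookup; insertAt-punchIn)
open import Data.Vec.Properties using ([]=⇒lookup; lookup⇒[]=; lookup∘tabulate; lookup-map)
open import Function.Base using (_∘_)
open import Function.Bundles using (_⇔_; mk⇔; Equivalence)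
open import Level using (Level; 0ℓ; _⊔_; Lift; lift; lower)
open import Relation.Binary.Core using (Rel)
open import Relation.Binary.Definitions using (Trichotomous; Transitive; tri<; tri≈; tri>)
import Relation.Binary.PropositionalEquality as ≡
open import Relation.Binary.PropositionalEquality using (_≡_; _≢_; _≗_)
open import Relation.Binary.Structures using (IsStrictTotalOrder; IsDecStrictPartialOrder)
open import Relation.Binary.Structures.Biased using (isStrictTotalOrderᶜ)
open import Relation.Nullary using (¬_; Dec; yes; no; does; ¬?; _⊎-dec_)
open import Relation.Nullary.Decidable using (dec-true; decidable-stable)
open import Relation.Unary using (Pred; Decidable)

-- Orthogonality of a row to cos θ and sin θ presupposes that its three support elements form a
-- ≺-chain, for only then are all its entries sines of differences taken in the right order.
-- Membership in 𝒞(≺) merely gives an alternating triple for each linear extension separately;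
-- comparability is recovered by testing against linear extensions built for the purpose. The sign
-- of the factor s can be read off at x₁, where Ĉ equals C(x₁) times a positive sine. Hence σ_C is
-- C(x₁) times the constant sign of the cofactor of row `zero` and column x₁, and it changes with C.
-- Trichotomy is the only case distinction available for real numbers, so a negated universal
-- statement gives no witness: the modulus of continuity of sin² at 0 has to be produced as a
-- supremum, and the intermediate value theorem is used as a refutation. The simplex hypothesis,
-- including its count of rows, speaks about respecting θ only; an explicit one is constructed both
-- to read off p = q + 1 and to serve as base point for the constant sign.

-- Ring solver coefficients: (a , b) stands for a − b and is kept in the normal
-- form in which a or b is 0, so that equal coefficients are identical.
module Difference where
  normalise : ℕ → ℕ → ℕ × ℕ
  normalise zero    b       = 0 , b
  normalise (suc a) zero    = suc a , 0
  normalise (suc a) (suc b) = normalise a b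

  rawRing : RawRing _ _
  rawRing = record
    { Carrier = ℕ × ℕ
    ; _≈_ = _≡_
    ; _+_ = λ { (a , b) (c , d) → normalise (a ℕ.+ c) (b ℕ.+ d) }
    ; _*_ = λ { (a , b) (c , d) → normalise (a ℕ.* c ℕ.+ b ℕ.* d) (a ℕ.* d ℕ.+ b ℕ.* c) }
    ; -_  = λ { (a , b) → b , a }
    ; 0#  = 0 , 0
    ; 1#  = 1 , 0
    }

-- Ordered fields: ring solver and strict inequalities

module OrderedField {c ℓ₁ ℓ₂} (ℝ : Reals c ℓ₁ ℓ₂) where
  open Reals ℝ renaming (zero to *-zero)
  open import Algebra.Properties.Ring ring
  open import Algebra.Properties.AbelianGroup +-abelianGroup using (⁻¹-∙-comm; ε⁻¹≈ε; ⁻¹-involutive)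
  open import Algebra.Properties.Semiring.Mult semiring using (×-homo-+; ×1-homo-*)
  open import Algebra.Definitions.RawMonoid +-rawMonoid using (_×′_)
  open import Algebra.Properties.CommutativeSemigroup +-commutativeSemigroup using (interchange)
  open import Relation.Binary.Reasoning.Setoid setoid

  module _ where
    private
      difference : ℕ → ℕ → Carrier
      difference a b = a · 1# - b · 1#

      -- The cases are chosen so that the constants 0, 1, 2, … of the solver
      -- are 0#, 1#, 1# + 1#, ….
      ⟦_⟧ : ℕ × ℕ → Carrier
      ⟦ a , zero ⟧  = a ×′ 1#
      ⟦ a , suc b ⟧ = difference a (suc b)

      ×′≈· : ∀ n → n ×′ 1# ≈ n · 1#
      ×′≈· 0 = refl
      ×′≈· 1 = sym (+-identityʳ 1#)
      ×′≈· (suc (suc n)) = trans (+-comm _ _) (+-congˡ (×′≈· (suc n)))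

      ⟦⟧≈difference : ∀ a b → ⟦ a , b ⟧ ≈ difference a b
      ⟦⟧≈difference a zero = begin
        a ×′ 1#      ≈⟨ ×′≈· a ⟩
        a · 1#       ≈⟨ +-identityʳ _ ⟨
        a · 1# + 0#  ≈⟨ +-congˡ ε⁻¹≈ε ⟨
        a · 1# - 0#  ∎
      ⟦⟧≈difference a (suc b) = refl

      cancel : ∀ x y z → (x + y) - (x + z) ≈ y - z
      cancel x y z = begin
        (x + y) - (x + z)      ≈⟨ +-congˡ (⁻¹-∙-comm x z) ⟨
        (x + y) + (- x + - z)  ≈⟨ interchange x y (- x) (- z) ⟩
        (x - x) + (y - z)      ≈⟨ +-congʳ (-‿inverseʳ x) ⟩
        0# + (y - z)           ≈⟨ +-identityˡ _ ⟩
        y - z                  ∎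

      normalise-correct : ∀ a b → ⟦ Difference.normalise a b ⟧ ≈ difference a b
      normalise-correct zero    b       = ⟦⟧≈difference 0 b
      normalise-correct (suc a) zero    = ⟦⟧≈difference (suc a) 0
      normalise-correct (suc a) (suc b) =
        trans (normalise-correct a b) (sym (cancel 1# (a · 1#) (b · 1#)))

      difference-+ : ∀ a b c d → difference (a ℕ.+ c) (b ℕ.+ d) ≈ difference a b + difference c d
      difference-+ a b c d = begin
        (a ℕ.+ c) · 1# - (b ℕ.+ d) · 1#
          ≈⟨ +-cong (×-homo-+ 1# a c) (-‿cong (×-homo-+ 1# b d)) ⟩
        (a · 1# + c · 1#) - (b · 1# + d · 1#)
          ≈⟨ +-congˡ (⁻¹-∙-comm _ _) ⟨
        (a · 1# + c · 1#) + (- (b · 1#) + - (d · 1#))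
          ≈⟨ interchange _ _ _ _ ⟩
        difference a b + difference c d ∎

      *-expand : ∀ x y z w → (x - y) * (z - w) ≈ (x * z + y * w) - (x * w + y * z)
      *-expand x y z w = begin
        (x - y) * (z - w)
          ≈⟨ distribʳ _ _ _ ⟩
        x * (z - w) + - y * (z - w)
          ≈⟨ +-cong (distribˡ _ _ _) (distribˡ _ _ _) ⟩
        (x * z + x * - w) + (- y * z + - y * - w)
          ≈⟨ +-cong (+-congˡ (sym (-‿distribʳ-* x w)))
                    (+-cong (sym (-‿distribˡ-* y z)) (trans (sym (-‿distribˡ-* y (- w))) (trans (-‿cong (sym (-‿distribʳ-* y w))) (⁻¹-involutive _)))) ⟩
        (x * z - x * w) + (- (y * z) + y * w)
          ≈⟨ +-congˡ (+-comm _ _) ⟩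
        (x * z - x * w) + (y * w - y * z)
          ≈⟨ interchange _ _ _ _ ⟩
        (x * z + y * w) + (- (x * w) + - (y * z))
          ≈⟨ +-congˡ (⁻¹-∙-comm _ _) ⟩
        (x * z + y * w) - (x * w + y * z) ∎

      difference-* : ∀ a b c d → difference (a ℕ.* c ℕ.+ b ℕ.* d) (a ℕ.* d ℕ.+ b ℕ.* c) ≈
                                 difference a b * difference c d
      difference-* a b c d = begin
        (a ℕ.* c ℕ.+ b ℕ.* d) · 1# - (a ℕ.* d ℕ.+ b ℕ.* c) · 1#
          ≈⟨ +-cong (homo a c b d) (-‿cong (homo a d b c)) ⟩
        (a · 1# * c · 1# + b · 1# * d · 1#) - (a · 1# * d · 1# + b · 1# * c · 1#)
          ≈⟨ *-expand _ _ _ _ ⟨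
        difference a b * difference c d ∎
        where
        homo : ∀ i j k l → (i ℕ.* j ℕ.+ k ℕ.* l) · 1# ≈ (i · 1#) * (j · 1#) + (k · 1#) * (l · 1#)
        homo i j k l = trans (×-homo-+ 1# (i ℕ.* j) (k ℕ.* l)) (+-cong (×1-homo-* i j) (×1-homo-* k l))

      difference-neg : ∀ a b → difference b a ≈ - difference a b
      difference-neg a b = begin
        b · 1# - a · 1#            ≈⟨ +-comm _ _ ⟩
        - (a · 1#) + b · 1#        ≈⟨ +-congˡ (⁻¹-involutive _) ⟨
        - (a · 1#) + - - (b · 1#)  ≈⟨ ⁻¹-∙-comm _ _ ⟩
        - (a · 1# - b · 1#)        ∎

      morphism : Difference.rawRing -Raw-AlmostCommutative⟶ fromCommutativeRing commutativeRing
      morphism = record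
        { ⟦_⟧    = ⟦_⟧
        ; +-homo = λ { (a , b) (c , d) → trans (normalise-correct (a ℕ.+ c) (b ℕ.+ d))
                       (trans (difference-+ a b c d)
                         (sym (+-cong (⟦⟧≈difference a b) (⟦⟧≈difference c d)))) }
        ; *-homo = λ { (a , b) (c , d) → trans (normalise-correct (a ℕ.* c ℕ.+ b ℕ.* d) (a ℕ.* d ℕ.+ b ℕ.* c))
                       (trans (difference-* a b c d)
                         (sym (*-cong (⟦⟧≈difference a b) (⟦⟧≈difference c d)))) }
        ; -‿homo = λ { (a , b) → trans (⟦⟧≈difference b a)
                       (trans (difference-neg a b) (-‿cong (sym (⟦⟧≈difference a b)))) }
        ; 0-homo = refl
        ; 1-homo = refl
        }

      _≟′_ : ∀ x y → Maybe (⟦ x ⟧ ≈ ⟦ y ⟧)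
      (a , b) ≟′ (c , d) with a ℕ.≟ c | b ℕ.≟ d
      ... | yes ≡.refl | yes ≡.refl = just refl
      ... | _          | _          = nothing

    open RingSolver Difference.rawRing (fromCommutativeRing commutativeRing) morphism _≟′_ public
      using (Polynomial; con; solve; _:+_; _:*_; _:-_; :-_; _:=_)

    infix 9 #_
    #_ : ∀ {n} → ℕ → Polynomial n
    # k = con (k , 0)

  open IsStrictTotalOrder isStrictTotalOrder public
    using (compare; <-respˡ-≈; <-respʳ-≈) renaming (trans to <-trans; irrefl to <-irrefl; asym to <-asym)

  <-resp : ∀ {x x′ y y′} → x ≈ x′ → y ≈ y′ → x < y → x′ < y′
  <-resp p q lt = <-respˡ-≈ p (<-respʳ-≈ q lt)

  <⇒0< : ∀ {x y} → x < y → 0# < y - x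
  <⇒0< {x} {y} lt = <-respˡ-≈ (-‿inverseʳ x) (+-monoˡ-< (- x) lt)

  0<⇒< : ∀ {x y} → 0# < y - x → x < y
  0<⇒< {x} {y} lt = <-resp (+-identityˡ x)
    (solve 2 (λ x y → (y :- x) :+ x := y) refl x y) (+-monoˡ-< x lt)

  +-mono-< : ∀ {x y z w} → x < y → z < w → x + z < y + w
  +-mono-< {x} {y} {z} {w} p q =
    <-trans (+-monoˡ-< z p) (<-resp (+-comm z y) (+-comm w y) (+-monoˡ-< y q))

  +-pos : ∀ {x y} → 0# < x → 0# < y → 0# < x + y
  +-pos p q = <-respˡ-≈ (+-identityˡ 0#) (+-mono-< p q)

  neg-pos : ∀ {x} → x < 0# → 0# < - x
  neg-pos {x} lt = <-respʳ-≈ (+-identityˡ (- x)) (<⇒0< lt)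

  neg-neg : ∀ {x} → 0# < x → - x < 0#
  neg-neg {x} lt = 0<⇒< (<-respʳ-≈ (solve 1 (λ x → x := # 0 :- :- x) refl x) lt)

  square-pos : ∀ {x} → ¬ x ≈ 0# → 0# < x * x
  square-pos {x} x≉0 with compare x 0#
  ... | tri< lt _ _ = <-respʳ-≈ (solve 1 (λ x → :- x :* :- x := x :* x) refl x) (*-pos (neg-pos lt) (neg-pos lt))
  ... | tri≈ _ eq _ = ⊥-elim (x≉0 eq)
  ... | tri> _ _ gt = *-pos gt gt

  >⇒≉0 : ∀ {x} → 0# < x → ¬ x ≈ 0#
  >⇒≉0 lt eq = <-irrefl (sym eq) lt

  <⇒≉0 : ∀ {x} → x < 0# → ¬ x ≈ 0#
  <⇒≉0 lt eq = <-irrefl eq lt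

  *-cancel-0 : ∀ {x y} → ¬ x ≈ 0# → x * y ≈ 0# → y ≈ 0#
  *-cancel-0 {x} {y} x≉0 xy≈0 with inverse x x≉0
  ... | x⁻¹ , xx⁻¹≈1 = begin
    y              ≈⟨ *-identityˡ y ⟨
    1# * y         ≈⟨ *-congʳ xx⁻¹≈1 ⟨
    x * x⁻¹ * y    ≈⟨ solve 3 (λ x z y → x :* z :* y := z :* (x :* y)) refl x x⁻¹ y ⟩
    x⁻¹ * (x * y)  ≈⟨ *-congˡ xy≈0 ⟩
    x⁻¹ * 0#       ≈⟨ zeroʳ x⁻¹ ⟩
    0#             ∎

  *-cancel-pos : ∀ {x y} → 0# < x → 0# < x * y → 0# < y
  *-cancel-pos {x} {y} 0<x 0<xy with compare y 0#
  ... | tri> _ _ gt = gt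
  ... | tri≈ _ eq _ = ⊥-elim (>⇒≉0 0<xy (trans (*-congˡ eq) (zeroʳ x)))
  ... | tri< lt _ _ = ⊥-elim (<-asym 0<xy (<-respˡ-≈ (sym eq) (neg-neg (*-pos 0<x (neg-pos lt)))))
    where
    eq : x * y ≈ - (x * - y)
    eq = solve 2 (λ x y → x :* y := :- (x :* :- y)) refl x y

-- Determinants and elimination

module Determinants {c ℓ₁ ℓ₂} (ℝ : Reals c ℓ₁ ℓ₂) where
  open Reals ℝ renaming (zero to *-zero)
  open OrderedField ℝ
  open Linear ℝ
  import Algebra.Properties.Semiring.Sum semiring as Sum
  open import Algebra.Properties.Ring ring using (-1*x≈-x)
  open import Relation.Binary.Reasoning.Setoid setoid

  -- A copy of  sum  that does not unfold, so that its arguments can be inferred.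
  opaque
    ∑ : ∀ {n} → Vector Carrier n → Carrier
    ∑ = sum

  opaque
    unfolding ∑

    ∑≈sum : ∀ {n} (f : Vector Carrier n) → ∑ f ≈ sum f
    ∑≈sum f = refl

    ∑-empty : (f : Vector Carrier 0) → ∑ f ≈ 0#
    ∑-empty f = refl

    ∑-suc : ∀ {n} (f : Vector Carrier (suc n)) → ∑ f ≈ f zero + ∑ (f ∘ suc)
    ∑-suc f = refl

    ∑-cong : ∀ {n} {f g : Vector Carrier n} → (∀ i → f i ≈ g i) → ∑ f ≈ ∑ g
    ∑-cong {f = f} {g} = Sum.sum-cong-≋ {x = f} {g}

    ∑-distrib-+ : ∀ {n} (f g : Vector Carrier n) → ∑ (λ i → f i + g i) ≈ ∑ f + ∑ g
    ∑-distrib-+ = Sum.∑-distrib-+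

    ∑-comm : ∀ {m n} (f : Fin m → Fin n → Carrier) → ∑ (λ i → ∑ (f i)) ≈ ∑ (λ j → ∑ λ i → f i j)
    ∑-comm = Sum.∑-comm

    *-distribˡ-∑ : ∀ {n} x (f : Vector Carrier n) → x * ∑ f ≈ ∑ (λ i → x * f i)
    *-distribˡ-∑ = Sum.*-distribˡ-sum

    *-distribʳ-∑ : ∀ {n} x (f : Vector Carrier n) → ∑ f * x ≈ ∑ (λ i → f i * x)
    *-distribʳ-∑ = Sum.*-distribʳ-sum

    ∑-remove : ∀ {n} k (f : Vector Carrier (suc n)) → ∑ f ≈ f k + ∑ (removeAt f k)
    ∑-remove k f = Sum.sum-remove {i = k} f

    ∑-zero : ∀ {n} {f : Vector Carrier n} → (∀ i → f i ≈ 0#) → ∑ f ≈ 0#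
    ∑-zero {n} {f} f≈0 = trans (∑-cong {f = f} {λ _ → 0#} f≈0) (Sum.sum-replicate-zero n)

  ∑-single : ∀ {n} {f : Vector Carrier n} k → (∀ i → i ≢ k → f i ≈ 0#) → ∑ f ≈ f k
  ∑-single {suc n} {f} k f≈0 = begin
    ∑ f                       ≈⟨ ∑-remove k f ⟩
    f k + ∑ (removeAt f k)    ≈⟨ +-congˡ (∑-zero λ i → f≈0 (punchIn k i) (punchInᵢ≢i k i)) ⟩
    f k + 0#                    ≈⟨ +-identityʳ _ ⟩
    f k                         ∎

  ∑-neg : ∀ {n} (f : Vector Carrier n) → ∑ (λ i → - f i) ≈ - ∑ f
  ∑-neg f = begin
    ∑ (λ i → - f i)       ≈⟨ ∑-cong (λ i → -1*x≈-x (f i)) ⟨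
    ∑ (λ i → - 1# * f i)  ≈⟨ *-distribˡ-∑ (- 1#) f ⟨
    - 1# * ∑ f            ≈⟨ -1*x≈-x _ ⟩
    - ∑ f                 ∎

  ∑-affine : ∀ {n} (f g : Vector Carrier n) x → ∑ (λ i → f i + x * g i) ≈ ∑ f + x * ∑ g
  ∑-affine f g x = trans (∑-distrib-+ f _) (+-congˡ (sym (*-distribˡ-∑ x g)))

  ε : ∀ {n} → Fin n → Carrier
  ε j = (- 1#) ^ toℕ j

  opaque
    unfolding ∑

    -- As `det` inspects a matrix only through `M zero` and `M (suc i)`, `det M` and
    -- `det (M zero ∷ M ∘ suc)` are definitionally equal. Hence lemmas about `r ∷ R` apply to any
    -- nonempty matrix without function extensionality.
    det-expand : ∀ {k} (r : Vector Carrier (suc k)) (R : Matrix k (suc k)) →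
                 det (r ∷ R) ≈ ∑ (λ j → ε j * (r j * det λ i l → R i (punchIn j l)))
    det-expand r R = refl

  det-expand-cong : ∀ {k} {r s : Vector Carrier (suc k)} {R S : Matrix k (suc k)} → (∀ j → r j ≈ s j) →
    (∀ j → det (λ i l → R i (punchIn j l)) ≈ det (λ i l → S i (punchIn j l))) → det (r ∷ R) ≈ det (s ∷ S)
  det-expand-cong {r = r} {s} {R} {S} r≈s R≈S = begin
    det (r ∷ R)
      ≈⟨ det-expand r R ⟩
    ∑ (λ j → ε j * (r j * det λ i l → R i (punchIn j l)))
      ≈⟨ ∑-cong (λ j → *-congˡ (*-cong (r≈s j) (R≈S j))) ⟩
    ∑ (λ j → ε j * (s j * det λ i l → S i (punchIn j l)))
      ≈⟨ det-expand s S ⟨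
    det (s ∷ S) ∎

  det-cong : ∀ {k} (M N : Matrix k k) → (∀ i j → M i j ≈ N i j) → det M ≈ det N
  det-cong {zero}  M N M≈N = refl
  det-cong {suc k} M N M≈N = det-expand-cong {r = M zero} {N zero} {M ∘ suc} {N ∘ suc} (M≈N zero)
    λ j → det-cong (λ i l → M (suc i) (punchIn j l)) (λ i l → N (suc i) (punchIn j l))
      λ i l → M≈N (suc i) (punchIn j l)

  private
    -- The Laplace expansion along two rows: `j` and `punchIn j l` run through all ordered pairs of
    -- distinct columns. The minor on the remaining columns is abstracted to a function `H` of the
    -- column selection, so that the induction in `doubleSum-antisym` can change it.
    doubleSum : ∀ {n} (r s : Vector Carrier (2 ℕ.+ n)) (H : (Fin n → Fin (2 ℕ.+ n)) → Carrier) → Carrier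
    doubleSum r s H = ∑ λ j → ∑ λ l →
      ε j * ε l * (r j * s (punchIn j l) * H (punchIn j ∘ punchIn l))

    module _ {n} (H : (Fin n → Fin (2 ℕ.+ n)) → Carrier)
             (H-cong : ∀ {σ τ} → σ ≗ τ → H σ ≈ H τ) where
      -- Column pairs are sorted by their use of column `zero`: `border r s` collects those where
      -- `r` takes it, `- border s r` those where `s` takes it (the sign is that of `ε (suc j)`),
      -- and `inner` those that avoid it.
      border inner : (r s : Vector Carrier (2 ℕ.+ n)) → Carrier
      border r s = ∑ λ l → ε l * (r zero * s (suc l) * H (suc ∘ punchIn l))
      inner r s = ∑ λ j → ∑ λ l → ε (suc j) * ε (suc l) *
        (r (suc j) * s (suc (punchIn j l)) * H (punchIn (suc j) ∘ punchIn (suc l)))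

      doubleSum-split : ∀ r s → doubleSum r s H ≈ border r s - border s r + inner r s
      doubleSum-split r s = begin
        doubleSum r s H
          ≈⟨ ∑-suc _ ⟩
        ∑ (λ l → 1# * ε l * (r zero * s (suc l) * H (suc ∘ punchIn l))) +
        ∑ (λ j → ∑ λ l → ε (suc j) * ε l * (r (suc j) * s (punchIn (suc j) l) * H (punchIn (suc j) ∘ punchIn l)))
          ≈⟨ +-cong (∑-cong λ l → *-congʳ (*-identityˡ (ε l)))
                    (trans (∑-cong λ j → ∑-suc _) (∑-distrib-+ _ _)) ⟩
        border r s + (∑ (λ j → ε (suc j) * 1# * (r (suc j) * s zero * H (suc ∘ punchIn j))) + inner r s)
          ≈⟨ +-congˡ (+-congʳ (∑-cong λ j →
               solve 4 (λ e x y h → (:- # 1 :* e) :* # 1 :* (x :* y :* h) := :- (e :* (y :* x :* h)))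
                 refl (ε j) (r (suc j)) (s zero) (H (suc ∘ punchIn j)))) ⟩
        border r s + (∑ (λ j → - (ε j * (s zero * r (suc j) * H (suc ∘ punchIn j)))) + inner r s)
          ≈⟨ +-congˡ (+-congʳ (∑-neg _)) ⟩
        border r s + (- border s r + inner r s)
          ≈⟨ +-assoc _ _ _ ⟨
        border r s - border s r + inner r s ∎

    doubleSum-antisym : ∀ {n} (H : (Fin n → Fin (2 ℕ.+ n)) → Carrier) →
      (∀ {σ τ} → σ ≗ τ → H σ ≈ H τ) →
      ∀ r s → doubleSum r s H + doubleSum s r H ≈ 0#
    inner-antisym : ∀ {n} (H : (Fin n → Fin (2 ℕ.+ n)) → Carrier)
      (H-cong : ∀ {σ τ} → σ ≗ τ → H σ ≈ H τ) →
      ∀ r s → inner H H-cong r s + inner H H-cong s r ≈ 0#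

    doubleSum-antisym H H-cong r s = begin
      doubleSum r s H + doubleSum s r H
        ≈⟨ +-cong (doubleSum-split H H-cong r s) (doubleSum-split H H-cong s r) ⟩
      (b - b′ + i) + (b′ - b + i′)
        ≈⟨ solve 4 (λ b b′ i i′ → (b :- b′ :+ i) :+ (b′ :- b :+ i′) := i :+ i′) refl b b′ i i′ ⟩
      i + i′
        ≈⟨ inner-antisym H H-cong r s ⟩
      0# ∎
      where
      b b′ i i′ : Carrier
      b = border H H-cong r s
      b′ = border H H-cong s r
      i = inner H H-cong r s
      i′ = inner H H-cong s r

    inner-antisym {zero}  H H-cong r s = trans (+-cong (inner≈0 r s) (inner≈0 s r)) (+-identityˡ 0#)
      where
      inner≈0 : ∀ r s → inner H H-cong r s ≈ 0#
      inner≈0 r s = ∑-zero λ j → ∑-empty _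
    inner-antisym {suc n} H H-cong r s = begin
      inner H H-cong r s + inner H H-cong s r
        ≈⟨ +-cong (step r s) (step s r) ⟩
      doubleSum (r ∘ suc) (s ∘ suc) (H ∘ liftFin 1) + doubleSum (s ∘ suc) (r ∘ suc) (H ∘ liftFin 1)
        ≈⟨ doubleSum-antisym (H ∘ liftFin 1) (λ eq → H-cong (lift-cong eq)) (r ∘ suc) (s ∘ suc) ⟩
      0# ∎
      where
      lift-cong : ∀ {m n} {σ τ : Fin m → Fin n} → σ ≗ τ → liftFin 1 σ ≗ liftFin 1 τ
      lift-cong eq zero    = ≡.refl
      lift-cong eq (suc x) = ≡.cong suc (eq x)
      punchIn-lift : ∀ {n} (j : Fin (suc (suc n))) l →
        punchIn (suc j) ∘ punchIn (suc l) ≗ liftFin 1 (punchIn j ∘ punchIn l)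
      punchIn-lift j l zero    = ≡.refl
      punchIn-lift j l (suc x) = ≡.refl
      step : ∀ r s → inner H H-cong r s ≈ doubleSum (r ∘ suc) (s ∘ suc) (H ∘ liftFin 1)
      step r s = ∑-cong λ j → ∑-cong λ l → *-cong
        (solve 2 (λ e d → (:- # 1 :* e) :* (:- # 1 :* d) := e :* d) refl (ε j) (ε l))
        (*-congˡ {x = r (suc j) * s (suc (punchIn j l))} (H-cong (punchIn-lift j l)))

  det-rows : ∀ {n} (r s : Vector Carrier (2 ℕ.+ n)) R →
             det (r ∷ s ∷ R) ≈ doubleSum r s (λ σ → det λ i l → R i (σ l))
  det-rows {n} r s R = trans (det-expand r (s ∷ R)) (∑-cong λ j → begin
    ε j * (r j * det ((s ∘ punchIn j) ∷ λ i l → R i (punchIn j l)))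
      ≈⟨ *-congˡ (*-congˡ (det-expand (s ∘ punchIn j) (λ i l → R i (punchIn j l)))) ⟩
    ε j * (r j * ∑ (λ l → ε l * (s (punchIn j l) * D j l)))
      ≈⟨ *-assoc _ _ _ ⟨
    ε j * r j * ∑ (λ l → ε l * (s (punchIn j l) * D j l))
      ≈⟨ *-distribˡ-∑ (ε j * r j) (λ l → ε l * (s (punchIn j l) * D j l)) ⟩
    ∑ (λ l → ε j * r j * (ε l * (s (punchIn j l) * D j l)))
      ≈⟨ ∑-cong (λ l → solve 5 (λ e r d s h → e :* r :* (d :* (s :* h)) := e :* d :* (r :* s :* h))
           refl (ε j) (r j) (ε l) (s (punchIn j l)) (D j l)) ⟩
    ∑ (λ l → ε j * ε l * (r j * s (punchIn j l) * D j l)) ∎)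
    where
    D : Fin (2 ℕ.+ n) → Fin (suc n) → Carrier
    D j l = det λ i x → R i (punchIn j (punchIn l x))

  det-swap : ∀ {n} (r s : Vector Carrier (2 ℕ.+ n)) R → det (r ∷ s ∷ R) ≈ - det (s ∷ r ∷ R)
  det-swap r s R = begin
    x                ≈⟨ solve 2 (λ x y → x := (x :+ y) :- y) refl x y ⟩
    (x + y) - y      ≈⟨ +-congʳ (trans (+-cong (det-rows r s R) (det-rows s r R))
                          (doubleSum-antisym H (λ {σ} {τ} eq → det-cong (λ i l → R i (σ l)) (λ i l → R i (τ l)) λ i l → reflexive (≡.cong (R i) (eq l))) r s)) ⟩
    0# - y           ≈⟨ +-identityˡ _ ⟩
    - y              ∎
    where
    x = det (r ∷ s ∷ R)
    y = det (s ∷ r ∷ R)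
    H = λ σ → det λ i l → R i (σ l)

  x+x≈0⇒x≈0 : ∀ {x} → x + x ≈ 0# → x ≈ 0#
  x+x≈0⇒x≈0 {x} eq with compare x 0#
  ... | tri< lt _ _ = ⊥-elim (<⇒≉0 (<-respʳ-≈ (+-identityˡ 0#) (+-mono-< lt lt)) eq)
  ... | tri≈ _ x≈0 _ = x≈0
  ... | tri> _ _ gt = ⊥-elim (>⇒≉0 (+-pos gt gt) eq)

  -- If the repeated row is the first of `R`, a swap gives D = -D, hence D = 0 in an ordered field.
  -- Otherwise the swap brings `R zero` to the front, and every cofactor still contains the repeated
  -- row.
  det-repeat : ∀ {k} (R : Matrix k (suc k)) i → det (R i ∷ R) ≈ 0#
  det-repeat {suc k} R zero = x+x≈0⇒x≈0 (begin
    D + D    ≈⟨ +-congˡ (det-swap (R zero) (R zero) (R ∘ suc)) ⟩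
    D - D    ≈⟨ -‿inverseʳ D ⟩
    0#       ∎)
    where D = det (R zero ∷ R)
  det-repeat {suc k} R (suc i) = begin
    det (R (suc i) ∷ R)
      ≈⟨ det-swap (R (suc i)) (R zero) (R ∘ suc) ⟩
    - det (R zero ∷ R (suc i) ∷ (R ∘ suc))
      ≈⟨ -‿cong (trans (det-expand (R zero) (R (suc i) ∷ (R ∘ suc))) (∑-zero λ j → trans
           (*-congˡ (trans (*-congˡ (det-repeat (λ x l → R (suc x) (punchIn j l)) i)) (zeroʳ _)))
           (zeroʳ _))) ⟩
    - 0#
      ≈⟨ solve 0 (:- # 0 := # 0) refl ⟩
    0# ∎

  det-sum-row : ∀ {k p} (u : Vector Carrier p) (N : Matrix p (suc k)) (R : Matrix k (suc k)) →
                det ((λ j → ∑ λ i → u i * N i j) ∷ R) ≈ ∑ (λ i → u i * det (N i ∷ R))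
  det-sum-row {k} u N R = begin
    det ((λ j → ∑ λ i → u i * N i j) ∷ R)
      ≈⟨ det-expand (λ j → ∑ λ i → u i * N i j) R ⟩
    ∑ (λ j → ε j * (∑ (λ i → u i * N i j) * D j))
      ≈⟨ ∑-cong (λ j → trans (*-congˡ {x = ε j} (*-distribʳ-∑ (D j) _)) (*-distribˡ-∑ (ε j) _)) ⟩
    ∑ (λ j → ∑ (λ i → ε j * (u i * N i j * D j)))
      ≈⟨ ∑-comm _ ⟩
    ∑ (λ i → ∑ (λ j → ε j * (u i * N i j * D j)))
      ≈⟨ ∑-cong (λ i → trans (∑-cong λ j →
           solve 4 (λ e u n d → e :* (u :* n :* d) := u :* (e :* (n :* d))) refl (ε j) (u i) (N i j) (D j))
           (trans (sym (*-distribˡ-∑ (u i) _)) (*-congˡ (sym (det-expand (N i) R))))) ⟩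
    ∑ (λ i → u i * det (N i ∷ R)) ∎
    where
    D : Fin (suc k) → Carrier
    D j = det λ i l → R i (punchIn j l)

  -- In the expansion by linearity each term other than `u zero * det M` repeats a row. `det-w`
  -- applies this to the simplex dependency.
  det-combination : ∀ {k} (u : Vector Carrier (suc k)) (M : Matrix (suc k) (suc k)) →
                    det ((λ j → ∑ λ i → u i * M i j) ∷ (M ∘ suc)) ≈ u zero * det M
  det-combination u M = begin
    det ((λ j → ∑ λ i → u i * M i j) ∷ (M ∘ suc))
      ≈⟨ trans (det-sum-row u M (M ∘ suc)) (∑-suc _) ⟩
    u zero * det M + ∑ (λ i → u (suc i) * det (M (suc i) ∷ (M ∘ suc)))
      ≈⟨ +-congˡ (∑-zero λ i → trans (*-congˡ (det-repeat (M ∘ suc) i)) (zeroʳ _)) ⟩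
    u zero * det M + 0#
      ≈⟨ +-identityʳ _ ⟩
    u zero * det M ∎

  det-affine-row : ∀ {k} (r s : Vector Carrier (suc k)) x R →
                   det ((λ j → r j + x * s j) ∷ R) ≈ det (r ∷ R) + x * det (s ∷ R)
  det-affine-row {k} r s x R = trans (det-expand (λ j → r j + x * s j) R) (trans
    (∑-cong λ j → solve 5 (λ e r x s d → e :* ((r :+ x :* s) :* d) := e :* (r :* d) :+ x :* (e :* (s :* d)))
      refl (ε j) (r j) x (s j) (det λ i l → R i (punchIn j l)))
    (trans (∑-affine _ _ x) (+-cong (sym (det-expand r R)) (*-congˡ (sym (det-expand s R))))))

  -- Expansion is along the first row, so `r` is swapped into second place: the cofactors are then
  -- sheared by a restriction of `r`, which the induction undoes, and the multiple of `r` left in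
  -- the first row contributes a determinant with a repeated row.
  det-shear : ∀ {k} (r : Vector Carrier (suc k)) (R : Matrix k (suc k)) (x : Vector Carrier k) →
              det (r ∷ λ i j → R i j + x i * r j) ≈ det (r ∷ R)
  det-shear {zero}  r R x = refl
  det-shear {suc k} r R x = begin
    det (r ∷ s′ ∷ R′)
      ≈⟨ det-swap r s′ R′ ⟩
    - det (s′ ∷ r ∷ R′)
      ≈⟨ -‿cong (det-expand-cong {r = s′} {s′} {r ∷ R′} {r ∷ (R ∘ suc)} (λ j → refl)
           λ j → det-shear (λ l → r (punchIn j l)) (λ i l → R (suc i) (punchIn j l)) (x ∘ suc)) ⟩
    - det (s′ ∷ r ∷ (R ∘ suc))
      ≈⟨ -‿cong (trans (det-affine-row (R zero) r (x zero) (r ∷ (R ∘ suc)))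
           (trans (+-congˡ (trans (*-congˡ (det-repeat (r ∷ (R ∘ suc)) zero)) (zeroʳ _))) (+-identityʳ _))) ⟩
    - det (R zero ∷ r ∷ (R ∘ suc))
      ≈⟨ det-swap r (R zero) (R ∘ suc) ⟨
    det (r ∷ R) ∎
    where
    s′ : Vector Carrier _
    s′ j = R zero j + x zero * r j
    R′ : Matrix _ _
    R′ i j = R (suc i) j + x (suc i) * r j

  det-zero-column : ∀ {k} (M : Matrix k k) j → (∀ i → M i j ≈ 0#) → det M ≈ 0#
  det-zero-column {suc k} M j M≈0 = trans (det-expand (M zero) (M ∘ suc))
    (∑-zero λ l → trans (*-congˡ (term l)) (zeroʳ _))
    where
    term : ∀ l → M zero l * det (λ i x → M (suc i) (punchIn l x)) ≈ 0#
    term l with l ≟ j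
    ... | yes ≡.refl = trans (*-congʳ (M≈0 zero)) (zeroˡ _)
    ... | no  l≢j = trans (*-congˡ (det-zero-column _ (punchOut l≢j) λ i →
            trans (reflexive (≡.cong (M (suc i)) (punchIn-punchOut l≢j))) (M≈0 (suc i)))) (zeroʳ _)

  det-single-column : ∀ {k} (r : Vector Carrier (suc k)) (R : Matrix k (suc k)) j → (∀ i → R i j ≈ 0#) →
                      det (r ∷ R) ≈ ε j * (r j * det λ i l → R i (punchIn j l))
  det-single-column r R j R≈0 = trans (det-expand r R) (∑-single j λ l l≢j → trans (*-congˡ
    (trans (*-congˡ (det-zero-column (λ i x → R i (punchIn l x)) (punchOut l≢j) λ i →
      trans (reflexive (≡.cong (R i) (punchIn-punchOut l≢j))) (R≈0 i))) (zeroʳ _))) (zeroʳ _))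

  det-single-row : ∀ {k} (r : Vector Carrier (suc k)) (R : Matrix k (suc k)) j → (∀ l → l ≢ j → r l ≈ 0#) →
                   det (r ∷ R) ≈ ε j * (r j * det λ i l → R i (punchIn j l))
  det-single-row r R j r≈0 = trans (det-expand r R) (∑-single j λ l l≢j → trans (*-congˡ
    (trans (*-congʳ (r≈0 l l≢j)) (zeroˡ _))) (zeroʳ _))

  ε≉0 : ∀ {n} (j : Fin n) → ¬ ε j ≈ 0#
  ε≉0 zero    1≈0 = >⇒≉0 0<1 1≈0
  ε≉0 (suc j) eq  = ε≉0 j (trans (solve 1 (λ x → x := :- (:- # 1 :* x)) refl (ε j))
    (trans (-‿cong eq) (solve 0 (:- # 0 := # 0) refl)))

  *-≉0 : ∀ {x y} → ¬ x ≈ 0# → ¬ y ≈ 0# → ¬ x * y ≈ 0#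
  *-≉0 x≉0 y≉0 eq = y≉0 (*-cancel-0 x≉0 eq)

  LeftKernelVector : ∀ {p q} → Matrix p q → Set (c ⊔ ℓ₁)
  LeftKernelVector {p} M = Σ[ ν ∈ Vector Carrier p ] ((∃[ i ] ¬ (ν i ≈ 0#)) × ∀ j → ∑ (λ i → ν i * M i j) ≈ 0#)

  RightInvertible : ∀ {p q} → Matrix p q → Set (c ⊔ ℓ₁)
  RightInvertible {p} {q} M = (b : Vector Carrier p) → Σ[ r ∈ Vector Carrier q ] (∀ i → ∑ (λ l → M i l * r l) ≈ b i)

  _≟ℝ_ : ∀ x y → Dec (x ≈ y)
  x ≟ℝ y with compare x y
  ... | tri< _ ¬eq _ = no ¬eq
  ... | tri≈ _ eq _  = yes eq
  ... | tri> _ ¬eq _ = no ¬eq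

  -- Elimination yields at once the nonzero determinant for `E≉0` and the solvability for
  -- `right-inverse`; in both places a kernel vector would contradict the uniqueness of the simplex
  -- dependency.
  singular-or-regular : ∀ {k} (M : Matrix k k) →
                        LeftKernelVector M ⊎ (¬ det M ≈ 0#) × RightInvertible M
  singular-or-regular {zero}  M = inj₂ (>⇒≉0 0<1 , λ b → (λ ()) , λ ())
  singular-or-regular {suc k} M with any? (λ j → ¬? (M zero j ≟ℝ 0#))
  ... | no none = inj₁ ((1# ∷ λ _ → 0#) , (zero , >⇒≉0 0<1) , λ j → begin
    ∑ (λ i → (1# ∷ λ _ → 0#) i * M i j)
      ≈⟨ ∑-suc _ ⟩
    1# * M zero j + ∑ (λ i → 0# * M (suc i) j)
      ≈⟨ +-cong (trans (*-identityˡ _) (decidable-stable (M zero j ≟ℝ 0#) λ ≉0 → none (j , ≉0)))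
                (∑-zero λ i → zeroˡ (M (suc i) j)) ⟩
    0# + 0#
      ≈⟨ +-identityˡ 0# ⟩
    0# ∎)
  ... | yes (j₀ , a≉0) = result (singular-or-regular N)
    where
    a a⁻¹ : Carrier
    a = M zero j₀
    a⁻¹ = proj₁ (inverse a a≉0)
    aa⁻¹≈1 : a * a⁻¹ ≈ 1#
    aa⁻¹≈1 = proj₂ (inverse a a≉0)
    -- Multiples of the first row that clear column `j₀` below the pivot `a`.
    x : Vector Carrier k
    x i = - (M (suc i) j₀ * a⁻¹)
    R : Matrix k (suc k)
    R i l = M (suc i) l + x i * M zero l
    N : Matrix k k
    N i l = R i (punchIn j₀ l)
    Rj₀≈0 : ∀ i → R i j₀ ≈ 0#
    Rj₀≈0 i = begin
      m + - (m * a⁻¹) * a     ≈⟨ solve 3 (λ m b a → m :+ :- (m :* b) :* a := m :- m :* (a :* b)) refl m a⁻¹ a ⟩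
      m - m * (a * a⁻¹)       ≈⟨ +-congˡ (-‿cong (*-congˡ aa⁻¹≈1)) ⟩
      m - m * 1#              ≈⟨ solve 1 (λ m → m :- m :* # 1 := # 0) refl m ⟩
      0#                      ∎
      where m = M (suc i) j₀
    det-M : det M ≈ ε j₀ * (a * det N)
    det-M = trans (sym (det-shear (M zero) (M ∘ suc) x)) (det-single-column (M zero) R j₀ Rj₀≈0)

    result : LeftKernelVector N ⊎ (¬ det N ≈ 0#) × RightInvertible N →
             LeftKernelVector M ⊎ (¬ det M ≈ 0#) × RightInvertible M
    result (inj₁ (ν , (i , νᵢ≉0) , dep)) = inj₁ ((t ∷ ν) , (suc i , νᵢ≉0) , dependency)
      where
      -- Each row of `R` contains `x i` times the first row of `M`; `t` collects these, so that a
      -- dependency of `R` becomes one of `M`.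
      t = ∑ λ i → ν i * x i
      R-dependency : ∀ l → ∑ (λ i → ν i * R i l) ≈ 0#
      R-dependency l with j₀ ≟ l
      ... | yes ≡.refl = ∑-zero λ i → trans (*-congˡ (Rj₀≈0 i)) (zeroʳ _)
      ... | no j₀≢l = ≡.subst (λ l → ∑ (λ i → ν i * R i l) ≈ 0#) (punchIn-punchOut j₀≢l) (dep (punchOut j₀≢l))
      dependency : ∀ l → ∑ (λ i → (t ∷ ν) i * M i l) ≈ 0#
      dependency l = begin
        ∑ (λ i → (t ∷ ν) i * M i l)
          ≈⟨ ∑-suc _ ⟩
        t * M zero l + ∑ (λ i → ν i * M (suc i) l)
          ≈⟨ +-congʳ (*-distribʳ-∑ (M zero l) _) ⟩
        ∑ (λ i → ν i * x i * M zero l) + ∑ (λ i → ν i * M (suc i) l)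
          ≈⟨ ∑-distrib-+ _ _ ⟨
        ∑ (λ i → ν i * x i * M zero l + ν i * M (suc i) l)
          ≈⟨ ∑-cong (λ i → solve 4 (λ v x m n → v :* x :* m :+ v :* n := v :* (n :+ x :* m))
               refl (ν i) (x i) (M zero l) (M (suc i) l)) ⟩
        ∑ (λ i → ν i * R i l)
          ≈⟨ R-dependency l ⟩
        0# ∎
    result (inj₂ (detN≉0 , solution)) =
      inj₂ ((λ detM≈0 → *-≉0 (ε≉0 j₀) (*-≉0 a≉0 detN≉0) (trans (sym det-M) detM≈0)) , λ b → solveFor b)
      where
      solveFor : RightInvertible M
      solveFor b = r , rows
        where
        -- The right-hand side undergoes the same row operations as `M`; the first equation then
        -- fixes the coordinate at `j₀`.
        r′ = proj₁ (solution λ i → b (suc i) + x i * b zero)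
        rest = ∑ λ l → M zero (punchIn j₀ l) * r′ l
        pivot = a⁻¹ * (b zero - rest)
        r : Vector Carrier (suc k)
        r = insertAt r′ j₀ pivot
        dot-r : ∀ (v : Vector Carrier (suc k)) →
                ∑ (λ l → v l * r l) ≈ v j₀ * pivot + ∑ (λ l → v (punchIn j₀ l) * r′ l)
        dot-r v = trans (∑-remove j₀ (λ l → v l * r l)) (+-cong
          (*-congˡ (reflexive (insertAt-lookup r′ j₀ pivot)))
          (∑-cong λ l → *-congˡ (reflexive (insertAt-punchIn r′ j₀ pivot l))))
        row₀ : ∑ (λ l → M zero l * r l) ≈ b zero
        row₀ = begin
          ∑ (λ l → M zero l * r l)                        ≈⟨ dot-r (M zero) ⟩
          a * (a⁻¹ * (b zero - rest)) + rest    ≈⟨ +-congʳ (sym (*-assoc _ _ _)) ⟩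
          a * a⁻¹ * (b zero - rest) + rest      ≈⟨ +-congʳ (*-congʳ aa⁻¹≈1) ⟩
          1# * (b zero - rest) + rest           ≈⟨ solve 2 (λ b s → # 1 :* (b :- s) :+ s := b) refl (b zero) rest ⟩
          b zero                                ∎
        rows : ∀ i → ∑ (λ l → M i l * r l) ≈ b i
        rows zero    = row₀
        rows (suc i) = begin
          ∑ (λ l → M (suc i) l * r l)
            ≈⟨ solve 2 (λ d y → d := (d :+ y) :- y) refl _ (x i * ∑ (λ l → M zero l * r l)) ⟩
          (∑ (λ l → M (suc i) l * r l) + x i * ∑ (λ l → M zero l * r l)) - x i * ∑ (λ l → M zero l * r l)
            ≈⟨ +-cong (trans (sym (∑-affine _ _ (x i))) (∑-cong λ l →
                 solve 4 (λ m z n r → m :* r :+ z :* (n :* r) := (m :+ z :* n) :* r) refl (M (suc i) l) (x i) (M zero l) (r l)))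
                 (-‿cong (*-congˡ row₀)) ⟩
          ∑ (λ l → R i l * r l) - x i * b zero
            ≈⟨ +-congʳ (dot-r (R i)) ⟩
          (R i j₀ * pivot + ∑ (λ l → N i l * r′ l)) - x i * b zero
            ≈⟨ +-congʳ (+-cong (trans (*-congʳ (Rj₀≈0 i)) (zeroˡ _)) (proj₂ (solution _) i)) ⟩
          (0# + (b (suc i) + x i * b zero)) - x i * b zero
            ≈⟨ solve 2 (λ c y → (# 0 :+ (c :+ y)) :- y := c) refl (b (suc i)) (x i * b zero) ⟩
          b (suc i) ∎

-- Continuity and the intermediate value theorem

module Continuity {c ℓ₁ ℓ₂} (ℝ : Reals c ℓ₁ ℓ₂) where
  open Reals ℝ renaming (zero to *-zero)
  open OrderedField ℝ
  open Determinants ℝ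
  open Linear ℝ

  -- Opaque, for otherwise with-abstraction unfolds the ring solver in these proofs.
  opaque
    ½ : Carrier
    ½ = proj₁ (inverse (1# + 1#) (>⇒≉0 (+-pos 0<1 0<1)))

    ½+½ : ∀ x → ½ * x + ½ * x ≈ x
    ½+½ x = trans (solve 2 (λ h x → h :* x :+ h :* x := # 2 :* h :* x) refl ½ x)
      (trans (*-congʳ (proj₂ (inverse (1# + 1#) (>⇒≉0 (+-pos 0<1 0<1))))) (*-identityˡ x))

    ½-pos : ∀ {x} → 0# < x → 0# < ½ * x
    ½-pos {x} 0<x = *-cancel-pos (+-pos 0<1 0<1) (<-respʳ-≈
      (trans (sym (½+½ x)) (solve 2 (λ h x → h :* x :+ h :* x := # 2 :* (h :* x)) refl ½ x)) 0<x)

    ½-< : ∀ {x} → 0# < x → ½ * x < x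
    ½-< {x} 0<x = 0<⇒< (<-respʳ-≈ (trans (solve 1 (λ y → y := (y :+ y) :- y) refl (½ * x)) (+-congʳ (½+½ x))) (½-pos 0<x))

  Within : Carrier → Carrier → Set ℓ₂
  Within ε x = (- ε < x) × (x < ε)

  within-resp : ∀ {ε ε′ x x′} → ε ≈ ε′ → x ≈ x′ → Within ε x → Within ε′ x′
  within-resp p q (l , u) = <-resp (-‿cong p) q l , <-resp q p u

  within-pos : ∀ {ε x} → 0# < x → x < ε → Within ε x
  within-pos 0<x x<ε = <-trans (neg-neg (<-trans 0<x x<ε)) 0<x , x<ε

  within-zero : ∀ {ε} → 0# < ε → Within ε 0#
  within-zero 0<ε = neg-neg 0<ε , 0<ε

  within-weaken : ∀ {ε δ x} → δ < ε → Within δ x → Within ε x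
  within-weaken {ε} {δ} δ<ε (l , u) = <-trans (0<⇒< (<-respʳ-≈
    (solve 2 (λ e d → e :- d := :- d :- :- e) refl ε δ) (<⇒0< δ<ε))) l , <-trans u δ<ε

  within-+ : ∀ {ε δ x y} → Within ε x → Within δ y → Within (ε + δ) (x + y)
  within-+ {ε} {δ} (l , u) (l′ , u′) =
    <-respˡ-≈ (solve 2 (λ e d → :- e :+ :- d := :- (e :+ d)) refl ε δ) (+-mono-< l l′) , +-mono-< u u′

  -- A case distinction on signs is avoided: 2(εδ + xy) = (ε - x)(δ - y) + (ε + x)(δ + y), and
  -- similarly for εδ - xy, are sums of products of positive factors.
  within-* : ∀ {ε δ x y} → Within ε x → Within δ y → Within (ε * δ) (x * y)
  within-* {ε} {δ} {x} {y} (l , u) (l′ , u′) =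
    0<⇒< (*-cancel-pos (+-pos 0<1 0<1) (<-respʳ-≈
      (solve 4 (λ e d x y → (e :- x) :* (d :- y) :+ (x :- :- e) :* (y :- :- d) := # 2 :* (x :* y :- :- (e :* d))) refl ε δ x y)
      (+-pos (*-pos (<⇒0< u) (<⇒0< u′)) (*-pos (<⇒0< l) (<⇒0< l′))))) ,
    0<⇒< (*-cancel-pos (+-pos 0<1 0<1) (<-respʳ-≈
      (solve 4 (λ e d x y → (e :- x) :* (y :- :- d) :+ (x :- :- e) :* (d :- y) := # 2 :* (e :* d :- x :* y)) refl ε δ x y)
      (+-pos (*-pos (<⇒0< u) (<⇒0< l′)) (*-pos (<⇒0< l) (<⇒0< u′)))))

  within-bound : ∀ x → Σ[ K ∈ Carrier ] (0# < K × Within K x)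
  within-bound x with compare x 0#
  ... | tri> _ _ 0<x = x + 1# , +-pos 0<x 0<1 , within-pos 0<x
          (0<⇒< (<-respʳ-≈ (solve 1 (λ x → # 1 := (x :+ # 1) :- x) refl x) 0<1))
  ... | tri≈ _ x≈0 _ = 1# , 0<1 , within-resp refl (sym x≈0) (within-zero 0<1)
  ... | tri< x<0 _ _ = - x + 1# , +-pos (neg-pos x<0) 0<1 ,
          0<⇒< (<-respʳ-≈ (solve 1 (λ x → # 1 := x :- :- (:- x :+ # 1)) refl x) 0<1) ,
          <-trans x<0 (+-pos (neg-pos x<0) 0<1)

  common : ∀ {ε δ} → 0# < ε → 0# < δ →
           Σ[ η ∈ Carrier ] (0# < η × ∀ x → Within η x → Within ε x × Within δ x)
  common {ε} {δ} 0<ε 0<δ with compare ε δ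
  ... | tri< lt _ _ = ε , 0<ε , λ x w → w , within-weaken lt w
  ... | tri≈ _ eq _ = ε , 0<ε , λ x w → w , within-resp eq refl w
  ... | tri> _ _ gt = δ , 0<δ , λ x w → within-weaken gt w , w

  Small : (Carrier → Carrier) → Set (c ⊔ ℓ₂)
  Small u = ∀ ε → 0# < ε → Σ[ δ ∈ Carrier ] (0# < δ × ∀ h → Within δ h → Within ε (u h))

  small-cong : ∀ {u v} → (∀ h → u h ≈ v h) → Small u → Small v
  small-cong u≈v su ε 0<ε with su ε 0<ε
  ... | δ , 0<δ , f = δ , 0<δ , λ h w → within-resp refl (u≈v h) (f h w)

  small-zero : Small (λ _ → 0#)
  small-zero ε 0<ε = 1# , 0<1 , λ _ _ → within-zero 0<ε

  small-id : Small (λ h → h)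
  small-id ε 0<ε = ε , 0<ε , λ _ w → w

  small-∘ : ∀ {u v} → Small u → Small v → Small (u ∘ v)
  small-∘ {u} {v} su sv ε 0<ε with su ε 0<ε
  ... | δ , 0<δ , f with sv δ 0<δ
  ... | η , 0<η , g = η , 0<η , λ h w → f (v h) (g h w)

  small-+ : ∀ {u v} → Small u → Small v → Small (λ h → u h + v h)
  small-+ su sv ε 0<ε with su (½ * ε) (½-pos 0<ε) | sv (½ * ε) (½-pos 0<ε)
  ... | δ , 0<δ , f | δ′ , 0<δ′ , g with common 0<δ 0<δ′
  ... | η , 0<η , both = η , 0<η , λ h w →
    within-resp (½+½ ε) refl (within-+ (f h (proj₁ (both h w))) (g h (proj₂ (both h w))))

  small-* : ∀ {u v} → Small u → Small v → Small (λ h → u h * v h)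
  small-* su sv ε 0<ε with su 1# 0<1 | sv ε 0<ε
  ... | δ , 0<δ , f | δ′ , 0<δ′ , g with common 0<δ 0<δ′
  ... | η , 0<η , both = η , 0<η , λ h w →
    within-resp (*-identityˡ ε) refl (within-* (f h (proj₁ (both h w))) (g h (proj₂ (both h w))))

  small-scale : ∀ {u} x → Small u → Small (λ h → x * u h)
  small-scale {u} x su ε 0<ε with within-bound x
  ... | K , 0<K , x<K with inverse K (>⇒≉0 0<K)
  ... | K⁻¹ , KK⁻¹≈1 with su (K⁻¹ * ε) (*-pos (*-cancel-pos 0<K (<-respʳ-≈ (sym KK⁻¹≈1) 0<1)) 0<ε)
  ... | δ , 0<δ , f = δ , 0<δ , λ h w → within-resp
    (trans (sym (*-assoc K K⁻¹ ε)) (trans (*-congʳ KK⁻¹≈1) (*-identityˡ ε))) refl (within-* x<K (f h w))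

  Continuous : (Carrier → Carrier) → Set (c ⊔ ℓ₂)
  Continuous f = ∀ x → Small (λ h → f (x + h) - f x)

  continuous-cong : ∀ {f g} → (∀ x → f x ≈ g x) → Continuous f → Continuous g
  continuous-cong f≈g cf x = small-cong (λ h → +-cong (f≈g (x + h)) (-‿cong (f≈g x))) (cf x)

  continuous-const : ∀ y → Continuous (λ _ → y)
  continuous-const y x = small-cong (λ _ → sym (-‿inverseʳ y)) small-zero

  continuous-+ : ∀ {f g} → Continuous f → Continuous g → Continuous (λ x → f x + g x)
  continuous-+ {f} {g} cf cg x = small-cong
    (λ h → solve 4 (λ a b c d → (a :- b) :+ (c :- d) := (a :+ c) :- (b :+ d)) refl (f (x + h)) (f x) (g (x + h)) (g x))
    (small-+ (cf x) (cg x))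

  continuous-* : ∀ {f g} → Continuous f → Continuous g → Continuous (λ x → f x * g x)
  continuous-* {f} {g} cf cg x = small-cong
    (λ h → solve 4 (λ a b c d → (a :- b) :* (c :- d) :+ (b :* (c :- d) :+ d :* (a :- b)) := a :* c :- b :* d)
      refl (f (x + h)) (f x) (g (x + h)) (g x))
    (small-+ (small-* (cf x) (cg x)) (small-+ (small-scale (f x) (cg x)) (small-scale (g x) (cf x))))

  continuous-neg : ∀ {f} → Continuous f → Continuous (λ x → - f x)
  continuous-neg {f} cf = continuous-cong (λ x → solve 1 (λ a → :- # 1 :* a := :- a) refl (f x))
    (continuous-* (continuous-const (- 1#)) cf)

  continuous-∑ : ∀ {n} (f : Fin n → Carrier → Carrier) → (∀ i → Continuous (f i)) → Continuous (λ x → ∑ λ i → f i x)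
  continuous-∑ {zero}  f cf = continuous-cong (λ x → sym (∑-empty λ i → f i x)) (continuous-const 0#)
  continuous-∑ {suc n} f cf = continuous-cong (λ x → sym (∑-suc λ i → f i x))
    (continuous-+ (cf zero) (continuous-∑ (f ∘ suc) (cf ∘ suc)))

  continuous-det : ∀ {k} (M : Carrier → Matrix k k) → (∀ i j → Continuous (λ x → M x i j)) → Continuous (λ x → det (M x))
  continuous-det {zero}  M cM = continuous-const 1#
  continuous-det {suc k} M cM = continuous-cong (λ x → sym (det-expand (M x zero) (M x ∘ suc)))
    (continuous-∑ _ λ j → continuous-* (continuous-const (ε j)) (continuous-* (cM zero j)
      (continuous-det (λ x i l → M x (suc i) (punchIn j l)) λ i l → cM (suc i) (punchIn j l))))

  private
    -- At the supremum `s` of the points of [0,1] where `f` is negative, a positive value would make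
    -- s - δ an upper bound, and a negative value with s < 1 would persist beyond `s`.
    root : ∀ {f} → (∀ {x y} → x ≈ y → f x ≈ f y) → Continuous f →
           f 0# < 0# → 0# < f 1# → (∀ t → ¬ t < 0# → ¬ 1# < t → ¬ f t ≈ 0#) → ⊥
    root {f} f-cong cf f0<0 0<f1 f≉0 = no-supremum (supremum Negative (0# , zero∈) (1# , ≤1))
      where
      Negative : Carrier → Set (c ⊔ ℓ₁ ⊔ ℓ₂)
      Negative t = Lift (c ⊔ ℓ₁) (¬ t < 0# × ¬ 1# < t × f t < 0#)
      zero∈ : Negative 0#
      zero∈ = lift (<-irrefl refl , <-asym 0<1 , f0<0)
      ≤1 : UpperBound Negative 1#
      ≤1 p = proj₁ (proj₂ (lower p))

      module _ (s : Carrier) (upper : UpperBound Negative s) (least : ∀ b → UpperBound Negative b → ¬ b < s) where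

        positive-at-s : ¬ 0# < f s
        positive-at-s 0<fs with cf s (f s) 0<fs
        ... | δ , 0<δ , near = least (s - δ) below (0<⇒< (<-respʳ-≈ (solve 2 (λ s d → d := s :- (s :- d)) refl s δ) 0<δ))
          where
          below : UpperBound Negative (s - δ)
          below {x} p s-δ<x = <-asym (proj₂ (proj₂ (lower p))) (0<⇒< (<-respʳ-≈
            (trans (solve 2 (λ a b → (a :- b) :- :- b := a :- # 0) refl (f (s + (x - s))) (f s))
              (+-congʳ (f-cong (solve 2 (λ s x → s :+ (x :- s) := x) refl s x))))
            (<⇒0< (proj₁ (near (x - s) (lower-bound , upper-bound))))))
            where
            lower-bound : - δ < x - s
            lower-bound = 0<⇒< (<-respʳ-≈ (solve 3 (λ x s d → x :- (s :- d) := (x :- s) :- :- d) refl x s δ) (<⇒0< s-δ<x))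
            upper-bound : x - s < δ
            upper-bound with compare (x - s) 0#
            ... | tri< lt _ _ = <-trans lt 0<δ
            ... | tri≈ _ eq _ = <-respˡ-≈ (sym eq) 0<δ
            ... | tri> _ _ gt = ⊥-elim (upper p (0<⇒< gt))

        negative-at-s : s < 1# → ¬ f s < 0#
        negative-at-s s<1 fs<0 with cf s (- f s) (neg-pos fs<0)
        -- The step to the right of `s` has to keep `f` negative and also stay below 1.
        ... | δ , 0<δ , near with common 0<δ (<⇒0< s<1)
        ... | η , 0<η , both = upper (lift ((λ lt → upper zero∈ (<-trans s<s+h lt)) , <-asym s+h<1 , f<0)) s<s+h
          where
          h : Carrier
          h = ½ * η
          0<h : 0# < h
          0<h = ½-pos 0<η
          inside : Within δ h × Within (1# - s) h
          inside = both h (within-pos 0<h (½-< 0<η))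
          s<s+h : s < s + h
          s<s+h = 0<⇒< (<-respʳ-≈ (solve 2 (λ s h → h := (s :+ h) :- s) refl s h) 0<h)
          s+h<1 : s + h < 1#
          s+h<1 = 0<⇒< (<-respʳ-≈ (solve 2 (λ s h → (# 1 :- s) :- h := # 1 :- (s :+ h)) refl s h) (<⇒0< (proj₂ (proj₂ inside))))
          f<0 : f (s + h) < 0#
          f<0 = 0<⇒< (<-respʳ-≈ (solve 2 (λ a b → :- b :- (a :- b) := # 0 :- a) refl (f (s + h)) (f s)) (<⇒0< (proj₂ (near h (proj₁ inside)))))

      no-supremum : ¬ (∃[ s ] (UpperBound Negative s × (∀ b → UpperBound Negative b → ¬ b < s)))
      no-supremum (s , upper , least) with compare (f s) 0# | compare s 1#
      ... | tri≈ _ fs≈0 _ | _              = f≉0 s (upper zero∈) (least 1# ≤1) fs≈0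
      ... | tri> _ _ 0<fs | _              = positive-at-s s upper least 0<fs
      ... | tri< fs<0 _ _ | tri≈ _ s≈1 _   = <-asym 0<f1 (<-respˡ-≈ (f-cong s≈1) fs<0)
      ... | tri< fs<0 _ _ | tri> _ _ 1<s   = least 1# ≤1 1<s
      ... | tri< fs<0 _ _ | tri< s<1 _ _   = negative-at-s s upper least s<1 fs<0

  sign-constant : ∀ {f} → (∀ {x y} → x ≈ y → f x ≈ f y) → Continuous f →
                  (∀ t → ¬ t < 0# → ¬ 1# < t → ¬ f t ≈ 0#) → ∀ σ → HasSign (f 0#) σ → HasSign (f 1#) σ
  sign-constant {f} f-cong cf f≉0 σ f0 with compare (f 1#) 0# | σ
  ... | tri≈ _ f1≈0 _ | _ = ⊥-elim (f≉0 1# (<-asym 0<1) (<-irrefl refl) f1≈0)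
  ... | tri< f1<0 _ _ | Sign.- = f1<0
  ... | tri> _ _ 0<f1 | Sign.+ = 0<f1
  ... | tri> _ _ 0<f1 | Sign.- = ⊥-elim (root f-cong cf f0 0<f1 f≉0)
  ... | tri< f1<0 _ _ | Sign.+ = ⊥-elim (root (λ eq → -‿cong (f-cong eq)) (continuous-neg cf) (neg-neg f0) (neg-pos f1<0)
          λ t 0≤t t≤1 -ft≈0 → f≉0 t 0≤t t≤1 (trans (solve 1 (λ x → x := :- :- x) refl (f t))
            (trans (-‿cong -ft≈0) (solve 0 (:- # 0 := # 0) refl))))

-- Sine and cosine from the addition formulas

module Trigonometric {c ℓ₁ ℓ₂} {ℝ : Reals c ℓ₁ ℓ₂} (trig : Trigonometry ℝ) where
  open Reals ℝ renaming (zero to *-zero)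
  open OrderedField ℝ
  open Continuity ℝ
  open Trigonometry trig
  open import Relation.Binary.Reasoning.Setoid setoid

  -- With c = cos 0 and s = sin 0 the addition formulas say c = c² - s² and s = 2sc; so c = c(c² +
  -- s²) = c(c² - s²) + s · 2sc = c² + s² = 1.
  cos-0 : cos 0# ≈ 1#
  cos-0 = begin
    cos 0#
      ≈⟨ *-identityʳ _ ⟨
    cos 0# * 1#
      ≈⟨ *-congˡ (cos²+sin²≈1 0#) ⟨
    cos 0# * (cos 0# * cos 0# + sin 0# * sin 0#)
      ≈⟨ solve 2 (λ c s → c :* (c :* c :+ s :* s) := c :* (c :* c :- s :* s) :+ s :* (s :* c :+ c :* s)) refl (cos 0#) (sin 0#) ⟩
    cos 0# * (cos 0# * cos 0# - sin 0# * sin 0#) + sin 0# * (sin 0# * cos 0# + cos 0# * sin 0#)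
      ≈⟨ +-cong (*-congˡ (trans (sym (cos-+ 0# 0#)) (cos-cong (+-identityˡ 0#))))
                (*-congˡ (trans (sym (sin-+ 0# 0#)) (sin-cong (+-identityˡ 0#)))) ⟩
    cos 0# * cos 0# + sin 0# * sin 0#
      ≈⟨ cos²+sin²≈1 0# ⟩
    1# ∎

  sin-0 : sin 0# ≈ 0#
  sin-0 = begin
    sin 0#
      ≈⟨ solve 1 (λ s → s := (s :* # 1 :+ # 1 :* s) :- s) refl (sin 0#) ⟩
    (sin 0# * 1# + 1# * sin 0#) - sin 0#
      ≈⟨ +-congʳ (+-cong (*-congˡ (sym cos-0)) (*-congʳ (sym cos-0))) ⟩
    (sin 0# * cos 0# + cos 0# * sin 0#) - sin 0#
      ≈⟨ +-congʳ (trans (sym (sin-+ 0# 0#)) (sin-cong (+-identityˡ 0#))) ⟩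
    sin 0# - sin 0#
      ≈⟨ -‿inverseʳ _ ⟩
    0# ∎

  module _ (x : Carrier) where
    private
      sin-cancel : sin x * cos (- x) + cos x * sin (- x) ≈ 0#
      sin-cancel = trans (sym (sin-+ x (- x))) (trans (sin-cong (-‿inverseʳ x)) sin-0)
      cos-cancel : cos x * cos (- x) - sin x * sin (- x) ≈ 1#
      cos-cancel = trans (sym (cos-+ x (- x))) (trans (cos-cong (-‿inverseʳ x)) cos-0)

    -- The addition formulas for x + (-x) are two linear equations in cos (-x) and sin (-x) with
    -- determinant -(cos² x + sin² x) = -1; they are solved here for the sine and in `cos-neg` for
    -- the cosine.
    sin-neg : sin (- x) ≈ - sin x
    sin-neg = begin
      sin (- x)
        ≈⟨ *-identityˡ _ ⟨
      1# * sin (- x)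
        ≈⟨ *-congʳ (cos²+sin²≈1 x) ⟨
      (cos x * cos x + sin x * sin x) * sin (- x)
        ≈⟨ solve 4 (λ c s c′ s′ → (c :* c :+ s :* s) :* s′ := c :* (s :* c′ :+ c :* s′) :- s :* (c :* c′ :- s :* s′))
             refl (cos x) (sin x) (cos (- x)) (sin (- x)) ⟩
      cos x * (sin x * cos (- x) + cos x * sin (- x)) - sin x * (cos x * cos (- x) - sin x * sin (- x))
        ≈⟨ +-cong (*-congˡ sin-cancel) (-‿cong (*-congˡ cos-cancel)) ⟩
      cos x * 0# - sin x * 1#
        ≈⟨ solve 2 (λ c s → c :* # 0 :- s :* # 1 := :- s) refl (cos x) (sin x) ⟩
      - sin x ∎

    cos-neg : cos (- x) ≈ cos x
    cos-neg = begin
      cos (- x)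
        ≈⟨ *-identityˡ _ ⟨
      1# * cos (- x)
        ≈⟨ *-congʳ (cos²+sin²≈1 x) ⟨
      (cos x * cos x + sin x * sin x) * cos (- x)
        ≈⟨ solve 4 (λ c s c′ s′ → (c :* c :+ s :* s) :* c′ := s :* (s :* c′ :+ c :* s′) :+ c :* (c :* c′ :- s :* s′))
             refl (cos x) (sin x) (cos (- x)) (sin (- x)) ⟩
      sin x * (sin x * cos (- x) + cos x * sin (- x)) + cos x * (cos x * cos (- x) - sin x * sin (- x))
        ≈⟨ +-cong (*-congˡ sin-cancel) (*-congˡ cos-cancel) ⟩
      sin x * 0# + cos x * 1#
        ≈⟨ solve 2 (λ c s → s :* # 0 :+ c :* # 1 := c) refl (cos x) (sin x) ⟩
      cos x ∎

  sin-difference : ∀ x y → sin (x - y) ≈ sin x * cos y - cos x * sin y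
  sin-difference x y = begin
    sin (x - y)                              ≈⟨ sin-+ x (- y) ⟩
    sin x * cos (- y) + cos x * sin (- y)    ≈⟨ +-cong (*-congˡ (cos-neg y)) (*-congˡ (sin-neg y)) ⟩
    sin x * cos y + cos x * - sin y          ≈⟨ solve 4 (λ a b c d → a :* b :+ c :* :- d := a :* b :- c :* d) refl (sin x) (cos y) (cos x) (sin y) ⟩
    sin x * cos y - cos x * sin y            ∎

  sin² : Carrier → Carrier
  sin² x = sin x * sin x

  -- Positivity of the sine is the only inequality assumed about it; this factorisation turns it
  -- into monotonicity of sin².
  sin²-difference : ∀ x y → sin (x + y) * sin (x - y) ≈ sin² x - sin² y
  sin²-difference x y = begin
    sin (x + y) * sin (x - y)
      ≈⟨ *-cong (sin-+ x y) (sin-difference x y) ⟩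
    (sin x * cos y + cos x * sin y) * (sin x * cos y - cos x * sin y)
      ≈⟨ solve 4 (λ s c s′ c′ → (s :* c′ :+ c :* s′) :* (s :* c′ :- c :* s′) :=
           s :* s :* (c′ :* c′ :+ s′ :* s′) :- s′ :* s′ :* (c :* c :+ s :* s)) refl (sin x) (cos x) (sin y) (cos y) ⟩
    sin² x * (cos y * cos y + sin² y) - sin² y * (cos x * cos x + sin² x)
      ≈⟨ +-cong (*-congˡ (cos²+sin²≈1 y)) (-‿cong (*-congˡ (cos²+sin²≈1 x))) ⟩
    sin² x * 1# - sin² y * 1#
      ≈⟨ +-cong (*-identityʳ _) (-‿cong (*-identityʳ _)) ⟩
    sin² x - sin² y ∎

  natural-pos : ∀ n → 0# < suc n · 1#
  natural-pos zero    = <-respʳ-≈ (sym (+-identityʳ 1#)) 0<1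
  natural-pos (suc n) = +-pos 0<1 (natural-pos n)

  -- Opaque, for otherwise the type checker expands the sum of 180 units.
  opaque
    π : Carrier
    π = 180 · 1#

  opaque
    unfolding π

    0<π : 0# < π
    0<π = natural-pos 179

    sin-positive : ∀ {x} → 0# < x → x < π → 0# < sin x
    sin-positive {x} = sin-pos x

    π≈180 : π ≈ 180 · 1#
    π≈180 = refl

  Acute : Carrier → Set ℓ₂
  Acute x = 0# < x × x + x < π

  acute⇒<π : ∀ {x} → Acute x → x < π
  acute⇒<π {x} (0<x , 2x<π) = <-trans (0<⇒< (<-respʳ-≈ (solve 1 (λ x → x := (x :+ x) :- x) refl x) 0<x)) 2x<π

  sin²-mono : ∀ {x y} → 0# < x → x < y → Acute y → sin² x < sin² y
  sin²-mono {x} {y} 0<x x<y acute = 0<⇒< (<-respʳ-≈ (sin²-difference y x) (*-pos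
    (sin-positive (+-pos (proj₁ acute) 0<x) (<-trans (0<⇒< (<-respʳ-≈ (solve 2 (λ x y → y :- x := (y :+ y) :- (y :+ x)) refl x y) (<⇒0< x<y))) (proj₂ acute)))
    (sin-positive (<⇒0< x<y) (<-trans (0<⇒< (<-respʳ-≈ (solve 2 (λ x y → x := y :- (y :- x)) refl x y) 0<x)) (acute⇒<π acute)))))

  acute-½ : ∀ {x} → Acute x → Acute (½ * x)
  acute-½ {x} acute = ½-pos (proj₁ acute) , <-respˡ-≈ (sym (½+½ x)) (acute⇒<π acute)

  -- With y = x/2, sin² x - 2 sin² y = 2 sin² y cos x, and cos x is positive because sin x and sin
  -- 2x = 2 sin x cos x are.
  sin²-double : ∀ {x} → Acute x → sin² (½ * x) + sin² (½ * x) < sin² x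
  sin²-double {x} acute@(0<x , 2x<π) = 0<⇒< (<-respʳ-≈ (sym identity) (*-pos
      (+-pos sin²y-pos sin²y-pos) cosx-pos))
    where
    y = ½ * x
    siny-pos = sin-positive (½-pos 0<x) (acute⇒<π (acute-½ acute))
    sin²y-pos : 0# < sin² y
    sin²y-pos = *-pos siny-pos siny-pos
    sinx-pos = sin-positive 0<x (acute⇒<π acute)
    cosx-pos : 0# < cos x
    cosx-pos = *-cancel-pos (+-pos sinx-pos sinx-pos) (<-respʳ-≈
      (trans (sin-+ x x) (solve 2 (λ s c → s :* c :+ c :* s := (s :+ s) :* c) refl (sin x) (cos x)))
      (sin-positive (+-pos 0<x 0<x) 2x<π))
    identity : sin² x - (sin² y + sin² y) ≈ (sin² y + sin² y) * cos x
    identity = begin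
      sin² x - (sin² y + sin² y)
        ≈⟨ +-cong (*-cong sin-x sin-x) (-‿cong (sym (trans (*-congˡ (cos²+sin²≈1 y)) (*-identityʳ _)))) ⟩
      (sin y * cos y + cos y * sin y) * (sin y * cos y + cos y * sin y) - (sin² y + sin² y) * (cos y * cos y + sin² y)
        ≈⟨ solve 2 (λ s c → (s :* c :+ c :* s) :* (s :* c :+ c :* s) :- (s :* s :+ s :* s) :* (c :* c :+ s :* s) :=
             (s :* s :+ s :* s) :* (c :* c :- s :* s)) refl (sin y) (cos y) ⟩
      (sin² y + sin² y) * (cos y * cos y - sin² y)
        ≈⟨ *-congˡ (trans (sym (cos-+ y y)) (cos-cong (½+½ x))) ⟩
      (sin² y + sin² y) * cos x ∎
      where
      sin-x : sin x ≈ sin y * cos y + cos y * sin y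
      sin-x = trans (sin-cong (sym (½+½ x))) (sin-+ y y)

  -- By sin²-double, a positive lower bound could be doubled indefinitely.
  sin²-unbounded-below : ∀ {ε} → 0# < ε → ¬ (∀ x → Acute x → ε < sin² x)
  sin²-unbounded-below {ε} 0<ε ε-lower =
    no-supremum (supremum Lower (ε , lift ε-lower) (sin² x₀ , λ p → <-asym (lower p x₀ acute₀)))
    where
    Lower : Carrier → Set (c ⊔ ℓ₁ ⊔ ℓ₂)
    Lower s = Lift ℓ₁ (∀ x → Acute x → s < sin² x)
    -- A sample acute angle, 45 degrees, whose sin² bounds `Lower` from above.
    x₀ = ½ * (½ * π)
    acute₀ : Acute x₀
    acute₀ = ½-pos (½-pos 0<π) , <-respˡ-≈ (sym (½+½ _)) (½-< 0<π)
    no-supremum : ¬ (∃[ L ] (UpperBound Lower L × (∀ b → UpperBound Lower b → ¬ b < L)))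
    no-supremum (L , upper , least) = least (½ * L) half-upper (½-< 0<L)
      where
      0<L : 0# < L
      0<L with compare 0# L
      ... | tri< lt _ _ = lt
      ... | tri≈ _ eq _ = ⊥-elim (upper (lift ε-lower) (<-respˡ-≈ eq 0<ε))
      ... | tri> _ _ gt = ⊥-elim (upper (lift ε-lower) (<-trans gt 0<ε))
      double : ∀ {s} → Lower s → Lower (s + s)
      double p = lift λ x acute →
        <-trans (+-mono-< (lower p (½ * x) (acute-½ acute)) (lower p (½ * x) (acute-½ acute))) (sin²-double acute)
      half-upper : UpperBound Lower (½ * L)
      half-upper p ½L<s = upper (double p) (<-respˡ-≈ (½+½ L) (+-mono-< ½L<s ½L<s))

  sin²-neg : ∀ x → sin² (- x) ≈ sin² x
  sin²-neg x = trans (*-cong (sin-neg x) (sin-neg x)) (solve 1 (λ s → :- s :* :- s := s :* s) refl (sin x))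

  sin²-0 : sin² 0# ≈ 0#
  sin²-0 = trans (*-congʳ sin-0) (zeroˡ _)

  opaque
    -- `sin²-unbounded-below` does not name an angle, so δ is taken as the supremum of the angles in
    -- [0,90) with sin² at most ε/2. Were it 0, every acute angle would have sin² above ε/2. The
    -- factor ½ leaves room for the strict bound ε.
    sin²-small : Small sin²
    sin²-small ε 0<ε = fromSupremum (supremum S (0# , zero∈S) (π , S<π))
      where
      S : Carrier → Set (c ⊔ ℓ₁ ⊔ ℓ₂)
      S x = Lift (c ⊔ ℓ₁) (¬ x < 0# × x + x < π × ¬ ½ * ε < sin² x)
      zero∈S : S 0#
      zero∈S = lift (<-irrefl refl , <-respˡ-≈ (sym (+-identityˡ 0#)) 0<π ,
        λ lt → <-asym (½-pos 0<ε) (<-respʳ-≈ sin²-0 lt))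
      S<π : UpperBound S π
      S<π p π<x = <-asym (proj₁ (proj₂ (lower p))) (<-trans π<x
        (<-respˡ-≈ (+-identityʳ _) (<-resp (+-comm _ _) refl (+-monoˡ-< _ (<-trans 0<π π<x)))))
      -ε<sin² : ∀ h → - ε < sin² h
      -ε<sin² h with compare (sin h) 0#
      ... | tri< _ ≉0 _ = <-trans (neg-neg 0<ε) (square-pos ≉0)
      ... | tri≈ _ ≈0 _ = <-respʳ-≈ (sym (trans (*-congʳ ≈0) (zeroˡ _))) (neg-neg 0<ε)
      ... | tri> _ ≉0 _ = <-trans (neg-neg 0<ε) (square-pos ≉0)

      module _ (δ : Carrier) (upper : UpperBound S δ) (least : ∀ b → UpperBound S b → ¬ b < δ) where

        lower-bound : 0# ≈ δ → ∀ x → Acute x → ½ * ε < sin² x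
        lower-bound 0≈δ x (0<x , 2x<π) with compare (½ * ε) (sin² x)
        ... | tri< lt _ _ = lt
        ... | tri≈ ≮ _ _ = ⊥-elim (upper (lift (<-asym 0<x , 2x<π , ≮)) (<-respˡ-≈ 0≈δ 0<x))
        ... | tri> ≮ _ _ = ⊥-elim (upper (lift (<-asym 0<x , 2x<π , ≮)) (<-respˡ-≈ 0≈δ 0<x))

        -- Otherwise monotonicity of sin² would make `h` an upper bound of `S` smaller than its
        -- supremum.
        ½ε≮sin² : ∀ {h} → 0# < h → h < δ → ¬ ½ * ε < sin² h
        ½ε≮sin² {h} 0<h h<δ lt = least h (λ {x} p h<x → proj₂ (proj₂ (lower p))
          (<-trans lt (sin²-mono 0<h h<x (<-trans 0<h h<x , proj₁ (proj₂ (lower p)))))) h<δ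

        positive : ∀ {h} → 0# < h → h < δ → sin² h < ε
        positive {h} 0<h h<δ with compare (sin² h) ε
        ... | tri< lt _ _ = lt
        ... | tri≈ _ eq _ = ⊥-elim (½ε≮sin² 0<h h<δ (<-respʳ-≈ (sym eq) (½-< 0<ε)))
        ... | tri> _ _ gt = ⊥-elim (½ε≮sin² 0<h h<δ (<-trans (½-< 0<ε) gt))

        sin²<ε : ∀ h → Within δ h → sin² h < ε
        sin²<ε h (-δ<h , h<δ) with compare h 0#
        ... | tri> _ _ 0<h = positive 0<h h<δ
        ... | tri≈ _ h≈0 _ = <-respˡ-≈ (sym (trans (*-cong (sin-cong h≈0) (sin-cong h≈0)) sin²-0)) 0<ε
        ... | tri< h<0 _ _ = <-respˡ-≈ (sin²-neg h) (positive (neg-pos h<0)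
                (0<⇒< (<-respʳ-≈ (solve 2 (λ h d → h :- :- d := d :- :- h) refl h δ) (<⇒0< -δ<h))))

      fromSupremum : ∃[ δ ] (UpperBound S δ × (∀ b → UpperBound S b → ¬ b < δ)) →
                     ∃[ δ ] (0# < δ × ∀ h → Within δ h → Within ε (sin² h))
      fromSupremum (δ , upper , least) with compare 0# δ
      ... | tri< 0<δ _ _ = δ , 0<δ , λ h w → -ε<sin² h , sin²<ε δ upper least h w
      ... | tri≈ _ 0≈δ _ = ⊥-elim (sin²-unbounded-below (½-pos 0<ε) (lower-bound δ upper least 0≈δ))
      ... | tri> _ _ δ<0 = ⊥-elim (upper zero∈S δ<0)

  square-<⇒< : ∀ {ε x} → 0# < ε → x * x < ε * ε → x < ε
  square-<⇒< {ε} {x} 0<ε x²<ε² with compare x ε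
  ... | tri< lt _ _ = lt
  ... | tri≈ _ eq _ = ⊥-elim (<-irrefl (*-cong eq eq) x²<ε²)
  ... | tri> _ _ gt = ⊥-elim (<-asym x²<ε² (0<⇒< (<-respʳ-≈
          (solve 2 (λ e x → (x :- e) :* (x :+ e) := x :* x :- e :* e) refl ε x)
          (*-pos (<⇒0< gt) (+-pos (<-trans 0<ε gt) 0<ε)))))

  sin-small : Small sin
  sin-small ε 0<ε with sin²-small (ε * ε) (*-pos 0<ε 0<ε)
  ... | δ , 0<δ , near = δ , 0<δ , λ h w →
    0<⇒< (<-respʳ-≈ (solve 2 (λ e x → e :- :- x := x :- :- e) refl ε (sin h))
      (<⇒0< (square-<⇒< 0<ε (<-respˡ-≈ (solve 1 (λ x → x :* x := :- x :* :- x) refl (sin h)) (proj₂ (near h w)))))) ,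
    square-<⇒< 0<ε (proj₂ (near h w))

  -- By cos h - 1 = -2 sin² (h/2), the estimate for sin² serves the cosine as well.
  cos-small : Small (λ h → cos h - 1#)
  cos-small = small-cong identity (small-scale (- (1# + 1#)) (small-∘ sin²-small (small-scale ½ small-id)))
    where
    identity : ∀ h → - (1# + 1#) * sin² (½ * h) ≈ cos h - 1#
    identity h = begin
      - (1# + 1#) * sin² y
        ≈⟨ solve 2 (λ s c → :- # 2 :* (s :* s) := (c :* c :- s :* s) :- (c :* c :+ s :* s)) refl (sin y) (cos y) ⟩
      (cos y * cos y - sin² y) - (cos y * cos y + sin² y)
        ≈⟨ +-cong (trans (sym (cos-+ y y)) (cos-cong (½+½ h))) (-‿cong (cos²+sin²≈1 y)) ⟩
      cos h - 1# ∎
      where y = ½ * h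

  -- Along a segment of angle vectors the differences of angles are affine in `t`. With a = α + tβ
  -- the increment is sin a (cos βh - 1) + cos a sin βh, so behaviour at 0 decides.
  continuous-sin-affine : ∀ α β → Continuous (λ t → sin (α + t * β))
  continuous-sin-affine α β t = small-cong identity
    (small-+ (small-scale (sin a) (small-∘ cos-small small-hβ)) (small-scale (cos a) (small-∘ sin-small small-hβ)))
    where
    a = α + t * β
    small-hβ : Small (λ h → β * h)
    small-hβ = small-scale β small-id
    identity : ∀ h → sin a * (cos (β * h) - 1#) + cos a * sin (β * h) ≈ sin (α + (t + h) * β) - sin a
    identity h = begin
      sin a * (cos (β * h) - 1#) + cos a * sin (β * h)
        ≈⟨ solve 4 (λ s c s′ c′ → s :* (c′ :- # 1) :+ c :* s′ := (s :* c′ :+ c :* s′) :- s) refl (sin a) (cos a) (sin (β * h)) (cos (β * h)) ⟩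
      (sin a * cos (β * h) + cos a * sin (β * h)) - sin a
        ≈⟨ +-congʳ (trans (sym (sin-+ a (β * h))) (sin-cong
             (solve 4 (λ a t b h → (a :+ t :* b) :+ b :* h := a :+ (t :+ h) :* b) refl α t β h))) ⟩
      sin (α + (t + h) * β) - sin a ∎

-- Alternating signed sets and linear extensions

module Circuits where
  open ≡ using (refl; sym; trans; subst; isEquivalence)

  -- Treats a circuit and its opposite together: `s` is the common sign of the two outer elements.
  SignPattern : ∀ {m} → SignedSet m → Sign → (e₁ e₂ e₃ : Fin m) → Set
  SignPattern X s e₁ e₂ e₃ =
    lookup X e₁ ≡ just s × lookup X e₂ ≡ just (opposite s) × lookup X e₃ ≡ just s ×
    (∀ e → e ≢ e₁ → e ≢ e₂ → e ≢ e₃ → lookup X e ≡ nothing)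

  s≢opposite : ∀ s → s ≢ opposite s
  s≢opposite Sign.+ ()
  s≢opposite Sign.- ()

  just≢nothing : ∀ {s : Sign} {x : Maybe Sign} → x ≡ just s → x ≢ nothing
  just≢nothing refl ()

  module _ {m : ℕ} (X : SignedSet m) where

    alternating⇒pattern : ∀ {e₁ e₂ e₃} → Alternating e₁ e₂ e₃ X → ∃[ s ] SignPattern X s e₁ e₂ e₃
    alternating⇒pattern {e₁} {e₂} {e₃} (inj₁ X≗) = Sign.+ ,
      from (proj₁ (X≗ e₁)) (inj₁ refl) , from (proj₂ (X≗ e₂)) refl , from (proj₁ (X≗ e₃)) (inj₂ refl) , off
      where
      open Equivalence
      off : ∀ e → e ≢ e₁ → e ≢ e₂ → e ≢ e₃ → lookup X e ≡ nothing
      off e ≢₁ ≢₂ ≢₃ with lookup X e | X≗ e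
      ... | nothing     | _      = refl
      ... | just Sign.+ | P , _  = ⊥-elim ([ ≢₁ , ≢₃ ]′ (to P refl))
      ... | just Sign.- | _ , N  = ⊥-elim (≢₂ (to N refl))
    alternating⇒pattern {e₁} {e₂} {e₃} (inj₂ X≗) = Sign.- ,
      from (proj₂ (X≗ e₁)) (inj₁ refl) , from (proj₁ (X≗ e₂)) refl , from (proj₂ (X≗ e₃)) (inj₂ refl) , off
      where
      open Equivalence
      off : ∀ e → e ≢ e₁ → e ≢ e₂ → e ≢ e₃ → lookup X e ≡ nothing
      off e ≢₁ ≢₂ ≢₃ with lookup X e | X≗ e
      ... | nothing     | _      = refl
      ... | just Sign.- | _ , N  = ⊥-elim ([ ≢₁ , ≢₃ ]′ (to N refl))
      ... | just Sign.+ | P , _  = ⊥-elim (≢₂ (to P refl))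

    pattern-reverse : ∀ {s e₁ e₂ e₃} → SignPattern X s e₁ e₂ e₃ → SignPattern X s e₃ e₂ e₁
    pattern-reverse (p₁ , p₂ , p₃ , off) = p₃ , p₂ , p₁ , λ e ≢₃ ≢₂ ≢₁ → off e ≢₁ ≢₂ ≢₃

    outer : ∀ {s e₁ e₂ e₃} → SignPattern X s e₁ e₂ e₃ → ∀ {e} → lookup X e ≡ just s → e ≡ e₁ ⊎ e ≡ e₃
    outer {s} {e₁} {e₂} {e₃} (p₁ , p₂ , p₃ , off) {e} p with e ≟ e₁ | e ≟ e₃ | e ≟ e₂
    ... | yes ≡₁ | _      | _        = inj₁ ≡₁
    ... | no _   | yes ≡₃ | _        = inj₂ ≡₃
    ... | no _   | no _   | yes refl = ⊥-elim (s≢opposite s (just-injective (trans (sym p) p₂)))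
    ... | no ≢₁  | no ≢₃  | no ≢₂    = ⊥-elim (just≢nothing p (off e ≢₁ ≢₂ ≢₃))

    middle : ∀ {s e₁ e₂ e₃} → SignPattern X s e₁ e₂ e₃ → ∀ {e} → lookup X e ≡ just (opposite s) → e ≡ e₂
    middle {s} {e₁} {e₂} {e₃} (p₁ , p₂ , p₃ , off) {e} p with e ≟ e₁ | e ≟ e₃ | e ≟ e₂
    ... | _        | _        | yes ≡₂ = ≡₂
    ... | yes refl | _        | no _   = ⊥-elim (s≢opposite s (just-injective (trans (sym p₁) p)))
    ... | no _     | yes refl | no _   = ⊥-elim (s≢opposite s (just-injective (trans (sym p₃) p)))
    ... | no ≢₁    | no ≢₃    | no ≢₂  = ⊥-elim (just≢nothing p (off e ≢₁ ≢₂ ≢₃))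

    -- The distinct elements `f₁` and `f₃` share the sign `t`, whereas the sign opposite to `s`
    -- occurs at `e₂` only.
    sameSign : ∀ {s t e₁ e₂ e₃ f₁ f₂ f₃} → f₁ ≢ f₃ → SignPattern X s e₁ e₂ e₃ → SignPattern X t f₁ f₂ f₃ → s ≡ t
    sameSign {Sign.+} {Sign.+} _ _ _ = refl
    sameSign {Sign.-} {Sign.-} _ _ _ = refl
    sameSign {Sign.+} {Sign.-} f₁≢f₃ e (q₁ , _ , q₃ , _) = ⊥-elim (f₁≢f₃ (trans (middle e q₁) (sym (middle e q₃))))
    sameSign {Sign.-} {Sign.+} f₁≢f₃ e (q₁ , _ , q₃ , _) = ⊥-elim (f₁≢f₃ (trans (middle e q₁) (sym (middle e q₃))))

  module PartialOrder {m : ℕ} (_≺_ : Rel (Fin m) 0ℓ) (isDSPO : IsDecStrictPartialOrder _≡_ _≺_) where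
    open IsDecStrictPartialOrder isDSPO using (irrefl; asym) renaming (trans to ≺-trans; _<?_ to _≺?_)

    below : Fin m → Subset m
    below e = Vec.tabulate λ f → does (f ≺? e)

    ∈below⁺ : ∀ {e f} → f ≺ e → f ∈ below e
    ∈below⁺ {e} {f} f≺e = lookup⇒[]= f (below e) (trans (lookup∘tabulate _ f) (dec-true (f ≺? e) f≺e))

    ∈below⁻ : ∀ {e f} → f ∈ below e → f ≺ e
    ∈below⁻ {e} {f} f∈ with f ≺? e | trans (sym (lookup∘tabulate (λ f → does (f ≺? e)) f)) ([]=⇒lookup f∈)
    ... | yes f≺e | _ = f≺e
    ... | no  _   | ()

    rank : Fin m → ℕ
    rank e = ∣ below e ∣

    rank-mono : ∀ {e f} → e ≺ f → rank e ℕ.< rank f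
    rank-mono {e} {f} e≺f = p⊂q⇒∣p∣<∣q∣
      ((λ x∈ → ∈below⁺ (≺-trans (∈below⁻ x∈) e≺f)) , e , ∈below⁺ e≺f , λ e∈ → irrefl refl (∈below⁻ e∈))

    rank≤m : ∀ e → rank e ℕ.≤ m
    rank≤m e = ∣p∣≤n (below e)

    -- A linear extension that places the up-set `U` after its complement. Ranks are at most `m`, so
    -- the offset `suc m` in `key` separates the two; equal keys are ordered by index.
    module UpSet {U : Pred (Fin m) 0ℓ} (U? : Decidable U) (up : ∀ {e f} → e ≺ f → U e → U f) where

      key : Fin m → ℕ
      key e = if does (U? e) then suc m ℕ.+ rank e else rank e

      infix 4 _⊏_
      _⊏_ : Rel (Fin m) 0ℓ
      e ⊏ f = key e ℕ.< key f ⊎ key e ≡ key f × e Fin.< f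

      split : ∀ {e f} → ¬ U e → U f → e ⊏ f
      split {e} {f} ¬Ue Uf with U? e | U? f
      ... | yes Ue | _     = ⊥-elim (¬Ue Ue)
      ... | no _   | no ¬Uf = ⊥-elim (¬Uf Uf)
      ... | no _   | yes _ = inj₁ (ℕ.s≤s (ℕ.≤-trans (rank≤m e) (ℕ.m≤m+n m (rank f))))

      ⊏-trans : Transitive _⊏_
      ⊏-trans (inj₁ p)       (inj₁ q)       = inj₁ (ℕ.<-trans p q)
      ⊏-trans (inj₁ p)       (inj₂ (q , _)) = inj₁ (subst (_ ℕ.<_) q p)
      ⊏-trans (inj₂ (p , _)) (inj₁ q)       = inj₁ (subst (ℕ._< _) (sym p) q)
      ⊏-trans (inj₂ (p , u)) (inj₂ (q , v)) = inj₂ (trans p q , Fin.<-trans u v)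

      ⊏-irrefl : ∀ {e} → ¬ e ⊏ e
      ⊏-irrefl (inj₁ p)       = ℕ.<-irrefl refl p
      ⊏-irrefl (inj₂ (_ , u)) = Fin.<-irrefl refl u

      ⊏-compare : Trichotomous _≡_ _⊏_
      ⊏-compare e f with ℕ.<-cmp (key e) (key f) | Fin.<-cmp e f
      ... | tri< lt _ _ | _ = tri< (inj₁ lt) (λ { refl → ⊏-irrefl {e} (inj₁ lt) }) (λ gt → ⊏-irrefl {e} (⊏-trans {e} {f} {e} (inj₁ lt) gt))
      ... | tri> _ _ gt | _ = tri> (λ lt → ⊏-irrefl {f} (⊏-trans {f} {e} {f} (inj₁ gt) lt)) (λ { refl → ⊏-irrefl {e} (inj₁ gt) }) (inj₁ gt)
      ... | tri≈ _ _  _ | tri≈ _ refl _ = tri≈ (⊏-irrefl {e}) refl (⊏-irrefl {e})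
      ... | tri≈ _ eq _ | tri< lt e≢f _ = tri< (inj₂ (eq , lt)) e≢f (λ gt → ⊏-irrefl {e} (⊏-trans {e} {f} {e} (inj₂ (eq , lt)) gt))
      ... | tri≈ _ eq _ | tri> _ e≢f gt = tri> (λ lt → ⊏-irrefl {f} (⊏-trans {f} {e} {f} (inj₂ (sym eq , gt)) lt)) e≢f (inj₂ (sym eq , gt))

      extends : ∀ {e f} → e ≺ f → e ⊏ f
      extends {e} {f} e≺f with U? e | U? f
      ... | yes _  | yes _  = inj₁ (ℕ.+-monoʳ-< (suc m) (rank-mono e≺f))
      ... | yes Ue | no ¬Uf = ⊥-elim (¬Uf (up e≺f Ue))
      ... | no _   | yes _  = inj₁ (ℕ.s≤s (ℕ.≤-trans (rank≤m e) (ℕ.m≤m+n m (rank f))))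
      ... | no _   | no _   = inj₁ (rank-mono e≺f)

      linearExtension : LinearExtension _≺_ _⊏_
      linearExtension = record
        { isStrictTotalOrder = isStrictTotalOrderᶜ record
            { isEquivalence = isEquivalence
            ; trans         = λ {e} {f} {g} → ⊏-trans {e} {f} {g}
            ; compare       = ⊏-compare
            }
        ; extends = λ {e} {f} → extends {e} {f}
        }

    Between : Rel (Fin m) 0ℓ → (e₁ e₂ e₃ : Fin m) → Set
    Between _<_ e₁ e₂ e₃ = (e₁ < e₂ × e₂ < e₃) ⊎ (e₃ < e₂ × e₂ < e₁)

    -- A linear extension can place e₂ below everything that is not ≼ e₂, and
    -- another can place it above everything that is not ≽ e₂; hence an element
    -- that is in the middle in every linear extension is comparable to both ends.
    between-all⇒between : ∀ {e₁ e₂ e₃} → e₁ ≢ e₂ → e₃ ≢ e₂ →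
      (∀ _<_ → LinearExtension _≺_ _<_ → Between _<_ e₁ e₂ e₃) → Between _≺_ e₁ e₂ e₃
    between-all⇒between {e₁} {e₂} {e₃} e₁≢e₂ e₃≢e₂ between = combine lowerEnd upperEnd
      where
      not-below? : ∀ e → Dec (¬ (e ≡ e₂ ⊎ e ≺ e₂))
      not-below? e = ¬? ((e ≟ e₂) ⊎-dec (e ≺? e₂))

      not-below-up : ∀ {e f} → e ≺ f → ¬ (e ≡ e₂ ⊎ e ≺ e₂) → ¬ (f ≡ e₂ ⊎ f ≺ e₂)
      not-below-up e≺f e⋠e₂ (inj₁ refl) = e⋠e₂ (inj₂ e≺f)
      not-below-up e≺f e⋠e₂ (inj₂ f≺e₂) = e⋠e₂ (inj₂ (≺-trans e≺f f≺e₂))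

      above? : ∀ e → Dec (e ≡ e₂ ⊎ e₂ ≺ e)
      above? e = (e ≟ e₂) ⊎-dec (e₂ ≺? e)

      above-up : ∀ {e f} → e ≺ f → e ≡ e₂ ⊎ e₂ ≺ e → f ≡ e₂ ⊎ e₂ ≺ f
      above-up e≺f (inj₁ refl) = inj₂ e≺f
      above-up e≺f (inj₂ e₂≺e) = inj₂ (≺-trans e₂≺e e≺f)

      module Low = UpSet not-below? not-below-up
      module High = UpSet above? above-up

      lowerEnd : e₁ ≺ e₂ ⊎ e₃ ≺ e₂
      lowerEnd with e₁ ≺? e₂ | e₃ ≺? e₂
      ... | yes p | _     = inj₁ p
      ... | no _  | yes p = inj₂ p
      ... | no p  | no q  = ⊥-elim (contradict (between Low._⊏_ Low.linearExtension))
        where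
        low : ∀ {e} → e ≢ e₂ → ¬ e ≺ e₂ → e₂ Low.⊏ e
        low {e} e≢e₂ e⊀e₂ = Low.split {e₂} {e} (λ ¬≼ → ¬≼ (inj₁ refl)) [ e≢e₂ , e⊀e₂ ]′
        contradict : ¬ Between Low._⊏_ e₁ e₂ e₃
        contradict (inj₁ (lt , _)) = Low.⊏-irrefl {e₁} (Low.⊏-trans {e₁} {e₂} {e₁} lt (low e₁≢e₂ p))
        contradict (inj₂ (lt , _)) = Low.⊏-irrefl {e₃} (Low.⊏-trans {e₃} {e₂} {e₃} lt (low e₃≢e₂ q))

      upperEnd : e₂ ≺ e₁ ⊎ e₂ ≺ e₃
      upperEnd with e₂ ≺? e₁ | e₂ ≺? e₃
      ... | yes p | _     = inj₁ p
      ... | no _  | yes p = inj₂ p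
      ... | no p  | no q  = ⊥-elim (contradict (between High._⊏_ High.linearExtension))
        where
        high : ∀ {e} → e ≢ e₂ → ¬ e₂ ≺ e → e High.⊏ e₂
        high {e} e≢e₂ e₂⊀e = High.split {e} {e₂} [ e≢e₂ , e₂⊀e ]′ (inj₁ refl)
        contradict : ¬ Between High._⊏_ e₁ e₂ e₃
        contradict (inj₁ (_ , lt)) = High.⊏-irrefl {e₃} (High.⊏-trans {e₃} {e₂} {e₃} (high e₃≢e₂ q) lt)
        contradict (inj₂ (_ , lt)) = High.⊏-irrefl {e₁} (High.⊏-trans {e₁} {e₂} {e₁} (high e₁≢e₂ p) lt)

      combine : e₁ ≺ e₂ ⊎ e₃ ≺ e₂ → e₂ ≺ e₁ ⊎ e₂ ≺ e₃ → Between _≺_ e₁ e₂ e₃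
      combine (inj₁ p) (inj₁ q) = ⊥-elim (asym p q)
      combine (inj₁ p) (inj₂ q) = inj₁ (p , q)
      combine (inj₂ p) (inj₁ q) = inj₂ (p , q)
      combine (inj₂ p) (inj₂ q) = ⊥-elim (asym p q)

    -- The signs of `X` alone determine the middle element and the pair of outer ones, so all linear
    -- extensions see the same triple, up to reversal, with `e₂` in the middle;
    -- `between-all⇒between` then makes it a chain.
    circuit-chain : ∀ X → (∀ _<_ → LinearExtension _≺_ _<_ → IsCircuit _<_ X) →
      ∃[ s ] ∃[ e₁ ] ∃[ e₂ ] ∃[ e₃ ] (e₁ ≺ e₂ × e₂ ≺ e₃ × SignPattern X s e₁ e₂ e₃)
    circuit-chain X circuit = from-first (circuit Any._⊏_ Any.linearExtension)
      where
      -- The empty up-set supplies one linear extension from which the triple is read off.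
      empty? : (e : Fin m) → Dec ⊥
      empty? _ = no λ ()

      module Any = UpSet empty? (λ _ b → b)

      from-first : IsCircuit Any._⊏_ X → _
      from-first (e₁ , e₂ , e₃ , e₁⊏e₂ , e₂⊏e₃ , alt) with alternating⇒pattern X alt
      ... | s , pat with between-all⇒between {e₁} {e₂} {e₃}
            (λ { refl → Any.⊏-irrefl {e₁} e₁⊏e₂ }) (λ { refl → Any.⊏-irrefl {e₃} e₂⊏e₃ })
            (λ _<_ ext → between _<_ ext (circuit _<_ ext))
        where
        between : ∀ _<_ → LinearExtension _≺_ _<_ → IsCircuit _<_ X → Between _<_ e₁ e₂ e₃
        between _<_ ext (f₁ , f₂ , f₃ , f₁<f₂ , f₂<f₃ , alt′) with alternating⇒pattern X alt′
        ... | t , pat′ with sameSign X (λ { refl → <-asym f₁<f₂ f₂<f₃ }) pat pat′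
          where open IsStrictTotalOrder (LinearExtension.isStrictTotalOrder ext) renaming (asym to <-asym)
        ... | refl with middle X pat {f₂} (proj₁ (proj₂ pat′)) | outer X pat {f₁} (proj₁ pat′) | outer X pat {f₃} (proj₁ (proj₂ (proj₂ pat′)))
        ... | refl | inj₁ refl | inj₂ refl = inj₁ (f₁<f₂ , f₂<f₃)
        ... | refl | inj₂ refl | inj₁ refl = inj₂ (f₁<f₂ , f₂<f₃)
        ... | refl | inj₁ refl | inj₁ refl = ⊥-elim (<-asym f₁<f₂ f₂<f₃)
          where open IsStrictTotalOrder (LinearExtension.isStrictTotalOrder ext) renaming (asym to <-asym)
        ... | refl | inj₂ refl | inj₂ refl = ⊥-elim (<-asym f₁<f₂ f₂<f₃)
          where open IsStrictTotalOrder (LinearExtension.isStrictTotalOrder ext) renaming (asym to <-asym)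
      ... | inj₁ (p , q) = s , e₁ , e₂ , e₃ , p , q , pat
      ... | inj₂ (p , q) = s , e₃ , e₂ , e₁ , p , q , pattern-reverse X pat

open Circuits

-- Three-element supports

SupportedOn : ∀ {m} → SignedSet m → (e f g : Fin m) → Set
SupportedOn X e f g = (∃[ s ] lookup X e ≡ just s) × (∃[ s ] lookup X f ≡ just s) × (∃[ s ] lookup X g ≡ just s) ×
  (∀ x → x ≢ e → x ≢ f → x ≢ g → lookup X x ≡ nothing)

triple : ∀ {m} → (e f g : Fin m) → Subset m
triple e f g = ⁅ e ⁆ ∪ (⁅ f ⁆ ∪ ⁅ g ⁆)

∈-triple⁻ : ∀ {m} {x e f g : Fin m} → x ∈ triple e f g → x ≡ e ⊎ x ≡ f ⊎ x ≡ g
∈-triple⁻ {e = e} {f} {g} x∈ with x∈p∪q⁻ ⁅ e ⁆ _ x∈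
... | inj₁ x∈e = inj₁ (x∈⁅y⁆⇒x≡y e x∈e)
... | inj₂ x∈fg with x∈p∪q⁻ ⁅ f ⁆ ⁅ g ⁆ x∈fg
... | inj₁ x∈f = inj₂ (inj₁ (x∈⁅y⁆⇒x≡y f x∈f))
... | inj₂ x∈g = inj₂ (inj₂ (x∈⁅y⁆⇒x≡y g x∈g))

∈-triple⁺ : ∀ {m} {x e f g : Fin m} → x ≡ e ⊎ x ≡ f ⊎ x ≡ g → x ∈ triple e f g
∈-triple⁺ {x = x} (inj₁ ≡.refl)        = x∈p∪q⁺ (inj₁ (x∈⁅x⁆ x))
∈-triple⁺ {x = x} (inj₂ (inj₁ ≡.refl)) = x∈p∪q⁺ (inj₂ (x∈p∪q⁺ (inj₁ (x∈⁅x⁆ x))))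
∈-triple⁺ {x = x} (inj₂ (inj₂ ≡.refl)) = x∈p∪q⁺ (inj₂ (x∈p∪q⁺ (inj₂ (x∈⁅x⁆ x))))

∈-support⁺ : ∀ {m} (X : SignedSet m) {x s} → lookup X x ≡ just s → x ∈ support X
∈-support⁺ X {x} eq = lookup⇒[]= x (support X) (≡.trans (lookup-map x is-just X) (≡.cong is-just eq))

∈-support⁻ : ∀ {m} (X : SignedSet m) {x} → x ∈ support X → lookup X x ≢ nothing
∈-support⁻ X {x} x∈ eq with ≡.trans (≡.sym ([]=⇒lookup x∈)) (≡.trans (lookup-map x is-just X) (≡.cong is-just eq))
... | ()

-- Brings the support into the literal form that `OtherTwo` compares with, in whatever order the
-- three elements are needed.
support-triple : ∀ {m} (X : SignedSet m) {e f g} → SupportedOn X e f g → support X ≡ triple e f g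
support-triple X {e} {f} {g} ((_ , pe) , (_ , pf) , (_ , pg) , off) = ⊆-antisym ⊆₁ ⊆₂
  where
  ⊆₁ : ∀ {x} → x ∈ support X → x ∈ triple e f g
  ⊆₁ {x} x∈ with x ≟ e | x ≟ f | x ≟ g
  ... | yes p | _     | _     = ∈-triple⁺ (inj₁ p)
  ... | no _  | yes p | _     = ∈-triple⁺ (inj₂ (inj₁ p))
  ... | no _  | no _  | yes p = ∈-triple⁺ (inj₂ (inj₂ p))
  ... | no p  | no q  | no r  = ⊥-elim (∈-support⁻ X x∈ (off x p q r))
  ⊆₂ : ∀ {x} → x ∈ triple e f g → x ∈ support X
  ⊆₂ x∈ with ∈-triple⁻ x∈
  ... | inj₁ ≡.refl        = ∈-support⁺ X pe
  ... | inj₂ (inj₁ ≡.refl) = ∈-support⁺ X pf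
  ... | inj₂ (inj₂ ≡.refl) = ∈-support⁺ X pg

-- Sums concentrated on few indices

module Sums {c ℓ₁ ℓ₂} (ℝ : Reals c ℓ₁ ℓ₂) where
  open Reals ℝ renaming (zero to *-zero)
  open OrderedField ℝ
  open Determinants ℝ

  -- Besides isolating summands in `∑-three`, it extends a vector given on chosen columns by zero in
  -- `right-inverse`.
  only : ∀ {m} → Fin m → Vector Carrier m → Vector Carrier m
  only k f e with e ≟ k
  ... | yes _ = f e
  ... | no  _ = 0#

  ∑-only : ∀ {m} (k : Fin m) f → ∑ (only k f) ≈ f k
  ∑-only k f = trans (∑-single k off) at
    where
    off : ∀ e → e ≢ k → only k f e ≈ 0#
    off e e≢k with e ≟ k
    ... | yes e≡k = ⊥-elim (e≢k e≡k)
    ... | no _    = refl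
    at : only k f k ≈ f k
    at with k ≟ k
    ... | yes _  = refl
    ... | no k≢k = ⊥-elim (k≢k ≡.refl)

  ∑-three : ∀ {m} {e₁ e₂ e₃ : Fin m} (f : Vector Carrier m) → e₁ ≢ e₂ → e₁ ≢ e₃ → e₂ ≢ e₃ →
            (∀ e → e ≢ e₁ → e ≢ e₂ → e ≢ e₃ → f e ≈ 0#) → ∑ f ≈ f e₁ + (f e₂ + f e₃)
  ∑-three {e₁ = e₁} {e₂} {e₃} f ≢₁₂ ≢₁₃ ≢₂₃ off = trans (∑-cong decompose)
    (trans (∑-distrib-+ _ _) (+-cong (∑-only e₁ f) (trans (∑-distrib-+ _ _) (+-cong (∑-only e₂ f) (∑-only e₃ f)))))
    where
    decompose : ∀ e → f e ≈ only e₁ f e + (only e₂ f e + only e₃ f e)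
    decompose e with e ≟ e₁ | e ≟ e₂ | e ≟ e₃
    ... | yes ≡.refl | yes e≡e₂   | _        = ⊥-elim (≢₁₂ e≡e₂)
    ... | yes ≡.refl | no _       | yes e≡e₃ = ⊥-elim (≢₁₃ e≡e₃)
    ... | no _       | yes ≡.refl | yes e≡e₃ = ⊥-elim (≢₂₃ e≡e₃)
    ... | yes _      | no _       | no _     = solve 1 (λ x → x := x :+ (# 0 :+ # 0)) refl (f e)
    ... | no _       | yes _      | no _     = solve 1 (λ x → x := # 0 :+ (x :+ # 0)) refl (f e)
    ... | no _       | no _       | yes _    = solve 1 (λ x → x := # 0 :+ (# 0 :+ x)) refl (f e)
    ... | no p       | no q       | no r     = trans (off e p q r) (solve 0 (# 0 := # 0 :+ (# 0 :+ # 0)) refl)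

  *-only : ∀ {m} (k : Fin m) (u f : Vector Carrier m) e → u e * only k f e ≈ only k (λ e → u e * f e) e
  *-only k u f e with e ≟ k
  ... | yes _ = refl
  ... | no  _ = zeroʳ _

  ∑-pos : ∀ {n} (f : Vector Carrier (suc n)) → (∀ i → 0# < f i) → 0# < ∑ f
  ∑-pos {zero}  f f>0 = <-respʳ-≈ (sym (trans (∑-suc f) (trans (+-congˡ (∑-empty _)) (+-identityʳ _)))) (f>0 zero)
  ∑-pos {suc n} f f>0 = <-respʳ-≈ (sym (∑-suc f)) (+-pos (f>0 zero) (∑-pos (f ∘ suc) (f>0 ∘ suc)))

  -- Associativity (xM)y = x(My), which turns the product of `w` with a vector into the
  -- μ-combination of the left-hand sides of the system.
  ∑-∑-* : ∀ {m n} (x : Vector Carrier m) (M : Fin m → Fin n → Carrier) (y : Vector Carrier n) →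
          ∑ (λ e → ∑ (λ i → x i * M i e) * y e) ≈ ∑ (λ i → x i * ∑ (λ e → M i e * y e))
  ∑-∑-* x M y = trans (∑-cong λ e → *-distribʳ-∑ (y e) _) (trans (∑-comm _) (∑-cong λ i →
    trans (∑-cong λ e → *-assoc _ _ _) (sym (*-distribˡ-∑ (x i) _))))

-- Rows of Σ(T) and angles respecting ≺

module TwistedMatrix {c ℓ₁ ℓ₂} {ℝ : Reals c ℓ₁ ℓ₂} (trig : Trigonometry ℝ)
                     {n m p : ℕ} (T : TwistedGraph n m p) where
  open Reals ℝ renaming (zero to *-zero)
  open OrderedField ℝ
  open Determinants ℝ
  open Continuity ℝ
  open Trigonometric trig
  open Sums ℝ
  open Trigonometry trig
  open TwistedGraph T
  open Linear ℝ
  open Twisted trig T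
  open IsDecStrictPartialOrder isDecStrictPartialOrder using (irrefl; asym) renaming (trans to ≺-trans)
  open PartialOrder _≺_ isDecStrictPartialOrder
  open import Relation.Binary.Reasoning.Setoid setoid

  ≺⇒≢ : ∀ {e f} → e ≺ f → e ≢ f
  ≺⇒≢ e≺f e≡f = irrefl e≡f e≺f

  -- `hat` uses whatever pair the search `otherTwo?` returns. That pair exhausts the support outside
  -- `e`, and asymmetry of ≺ fixes its order, so it is (f , g).
  hat-supported : ∀ θ X {e f g} → SupportedOn X e f g → e ≢ f → e ≢ g → f ≺ g →
                  hat θ X e ≈ value (lookup X e) * sin (θ g - θ f)
  hat-supported θ X {e} {f} {g} supp e≢f e≢g f≺g with otherTwo? X e
  ... | no none = ⊥-elim (none (f , g , support-triple X supp , f≺g))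
  ... | yes (f′ , g′ , supp′ , f′≺g′)
      with ∈-triple⁻ (≡.subst (f ∈_) (≡.trans (≡.sym (support-triple X supp)) supp′) (∈-triple⁺ (inj₂ (inj₁ ≡.refl))))
         | ∈-triple⁻ (≡.subst (g ∈_) (≡.trans (≡.sym (support-triple X supp)) supp′) (∈-triple⁺ (inj₂ (inj₂ ≡.refl))))
  ... | inj₁ f≡e            | _                    = ⊥-elim (e≢f (≡.sym f≡e))
  ... | inj₂ _              | inj₁ g≡e             = ⊥-elim (e≢g (≡.sym g≡e))
  ... | inj₂ (inj₁ ≡.refl) | inj₂ (inj₁ g≡f)      = ⊥-elim (≺⇒≢ f≺g (≡.sym g≡f))
  ... | inj₂ (inj₁ ≡.refl) | inj₂ (inj₂ ≡.refl)   = refl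
  ... | inj₂ (inj₂ ≡.refl) | inj₂ (inj₁ ≡.refl)   = ⊥-elim (asym f≺g f′≺g′)
  ... | inj₂ (inj₂ ≡.refl) | inj₂ (inj₂ g≡f)      = ⊥-elim (≺⇒≢ f≺g (≡.sym g≡f))

  hat-off : ∀ θ X {e} → lookup X e ≡ nothing → hat θ X e ≈ 0#
  hat-off θ X {e} eq with otherTwo? X e
  ... | yes _ = trans (*-congʳ (reflexive (≡.cong value eq))) (zeroˡ _)
  ... | no _  = refl

  hat-cong : ∀ {θ θ′} X e → (∀ f → θ f ≈ θ′ f) → hat θ X e ≈ hat θ′ X e
  hat-cong X e θ≈θ′ with otherTwo? X e
  ... | yes (f , g , _) = *-congˡ (sin-cong (+-cong (θ≈θ′ g) (-‿cong (θ≈θ′ f))))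
  ... | no _ = refl

  value-opposite : ∀ s → value (just (opposite s)) ≈ - value (just s)
  value-opposite Sign.+ = refl
  value-opposite Sign.- = solve 0 (# 1 := :- :- # 1) refl

  value² : ∀ s → value (just s) * value (just s) ≈ 1#
  value² Sign.+ = *-identityˡ 1#
  value² Sign.- = solve 0 (:- # 1 :* :- # 1 := # 1) refl

  -- Expansion along the first row of 3×3 determinants with a repeated row: the columns belong to x,
  -- y, z, the lower rows are cos and sin, the first row is cos or sin again, and sin (z - y) is the
  -- minor of the columns y, z.
  sine-relation : ∀ x y z → sin (z - y) * cos x - sin (z - x) * cos y + sin (y - x) * cos z ≈ 0# ×
                            sin (z - y) * sin x - sin (z - x) * sin y + sin (y - x) * sin z ≈ 0#
  sine-relation x y z =
    trans (+-cong (+-cong (*-congʳ (sin-difference z y)) (-‿cong (*-congʳ (sin-difference z x)))) (*-congʳ (sin-difference y x)))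
      (solve 6 (λ sx cx sy cy sz cz → (sz :* cy :- cz :* sy) :* cx :- (sz :* cx :- cz :* sx) :* cy :+ (sy :* cx :- cy :* sx) :* cz := # 0)
        refl (sin x) (cos x) (sin y) (cos y) (sin z) (cos z)) ,
    trans (+-cong (+-cong (*-congʳ (sin-difference z y)) (-‿cong (*-congʳ (sin-difference z x)))) (*-congʳ (sin-difference y x)))
      (solve 6 (λ sx cx sy cy sz cz → (sz :* cy :- cz :* sy) :* sx :- (sz :* cx :- cz :* sx) :* sy :+ (sy :* cx :- cy :* sx) :* sz := # 0)
        refl (sin x) (cos x) (sin y) (cos y) (sin z) (cos z))

  module Chain (θ : Fin m → Carrier) (X : SignedSet m) {s : Sign} {e₁ e₂ e₃ : Fin m}
               (e₁≺e₂ : e₁ ≺ e₂) (e₂≺e₃ : e₂ ≺ e₃) (pat : SignPattern X s e₁ e₂ e₃) where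
    private
      X₁ = proj₁ pat
      X₂ = proj₁ (proj₂ pat)
      X₃ = proj₁ (proj₂ (proj₂ pat))
      off = proj₂ (proj₂ (proj₂ pat))
      v = value (just s)

    ≢₁₂ : e₁ ≢ e₂
    ≢₁₂ = ≺⇒≢ e₁≺e₂
    ≢₂₃ : e₂ ≢ e₃
    ≢₂₃ = ≺⇒≢ e₂≺e₃
    ≢₁₃ : e₁ ≢ e₃
    ≢₁₃ = ≺⇒≢ (≺-trans e₁≺e₂ e₂≺e₃)

    hat₁ : hat θ X e₁ ≈ value (just s) * sin (θ e₃ - θ e₂)
    hat₁ = trans (hat-supported θ X ((_ , X₁) , (_ , X₂) , (_ , X₃) , off) ≢₁₂ ≢₁₃ e₂≺e₃)
      (*-congʳ (reflexive (≡.cong value X₁)))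

    hat₂ : hat θ X e₂ ≈ - value (just s) * sin (θ e₃ - θ e₁)
    hat₂ = trans (hat-supported θ X ((_ , X₂) , (_ , X₁) , (_ , X₃) , λ x p q r → off x q p r)
        (≢₁₂ ∘ ≡.sym) ≢₂₃ (≺-trans e₁≺e₂ e₂≺e₃))
      (*-congʳ (trans (reflexive (≡.cong value X₂)) (value-opposite s)))

    hat₃ : hat θ X e₃ ≈ value (just s) * sin (θ e₂ - θ e₁)
    hat₃ = trans (hat-supported θ X ((_ , X₃) , (_ , X₁) , (_ , X₂) , λ x p q r → off x q r p)
        (≢₁₃ ∘ ≡.sym) (≢₂₃ ∘ ≡.sym) e₁≺e₂)
      (*-congʳ (reflexive (≡.cong value X₃)))

    hat≈0 : ∀ e → e ≢ e₁ → e ≢ e₂ → e ≢ e₃ → hat θ X e ≈ 0#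
    hat≈0 e p q r = hat-off θ X (off e p q r)

    hat-kernel : ∀ (g : Carrier → Carrier) →
      sin (θ e₃ - θ e₂) * g (θ e₁) - sin (θ e₃ - θ e₁) * g (θ e₂) + sin (θ e₂ - θ e₁) * g (θ e₃) ≈ 0# →
      ∑ (λ e → hat θ X e * g (θ e)) ≈ 0#
    hat-kernel g eq = begin
      ∑ (λ e → hat θ X e * g (θ e))
        ≈⟨ ∑-three _ ≢₁₂ ≢₁₃ ≢₂₃ (λ e p q r → trans (*-congʳ (hat≈0 e p q r)) (zeroˡ _)) ⟩
      hat θ X e₁ * g₁ + (hat θ X e₂ * g₂ + hat θ X e₃ * g₃)
        ≈⟨ +-cong (*-congʳ hat₁) (+-cong (*-congʳ hat₂) (*-congʳ hat₃)) ⟩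
      v * a₁ * g₁ + (- v * a₂ * g₂ + v * a₃ * g₃)
        ≈⟨ solve 7 (λ v a₁ a₂ a₃ g₁ g₂ g₃ → v :* a₁ :* g₁ :+ (:- v :* a₂ :* g₂ :+ v :* a₃ :* g₃) :=
             v :* (a₁ :* g₁ :- a₂ :* g₂ :+ a₃ :* g₃)) refl v a₁ a₂ a₃ g₁ g₂ g₃ ⟩
      v * (a₁ * g₁ - a₂ * g₂ + a₃ * g₃)
        ≈⟨ *-congˡ eq ⟩
      v * 0#
        ≈⟨ zeroʳ v ⟩
      0# ∎
      where
      g₁ g₂ g₃ a₁ a₂ a₃ : Carrier
      g₁ = g (θ e₁)
      g₂ = g (θ e₂)
      g₃ = g (θ e₃)
      a₁ = sin (θ e₃ - θ e₂)
      a₂ = sin (θ e₃ - θ e₁)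
      a₃ = sin (θ e₂ - θ e₁)

    module _ (w : Vector Carrier m) (w≈0 : ∀ e → e ≢ e₁ → e ≢ e₂ → e ≢ e₃ → w e ≈ 0#)
             (w⊥cos : ∑ (λ e → w e * cos (θ e)) ≈ 0#) (w⊥sin : ∑ (λ e → w e * sin (θ e)) ≈ 0#) where
      private
        w₁ w₂ w₃ c₁ c₂ c₃ s₁ s₂ s₃ : Carrier
        w₁ = w e₁
        w₂ = w e₂
        w₃ = w e₃
        c₁ = cos (θ e₁)
        c₂ = cos (θ e₂)
        c₃ = cos (θ e₃)
        s₁ = sin (θ e₁)
        s₂ = sin (θ e₂)
        s₃ = sin (θ e₃)

        three-terms : ∀ (g : Fin m → Carrier) → ∑ (λ e → w e * g e) ≈ 0# → w₁ * g e₁ + (w₂ * g e₂ + w₃ * g e₃) ≈ 0#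
        three-terms g eq = trans (sym (∑-three _ ≢₁₂ ≢₁₃ ≢₂₃ (λ e p q r → trans (*-congʳ (w≈0 e p q r)) (zeroˡ _)))) eq

        drop-zeros : ∀ {x y z y′ z′} → y′ ≈ 0# → z′ ≈ 0# → (x + y * y′) - z * z′ ≈ x
        drop-zeros {x} {y} {z} y′≈0 z′≈0 = trans (+-cong (+-congˡ (*-congˡ y′≈0)) (-‿cong (*-congˡ z′≈0)))
          (solve 3 (λ x y z → (x :+ y :* # 0) :- z :* # 0 := x) refl x y z)

        w⊥c : w₁ * c₁ + (w₂ * c₂ + w₃ * c₃) ≈ 0#
        w⊥c = three-terms (cos ∘ θ) w⊥cos

        w⊥s : w₁ * s₁ + (w₂ * s₂ + w₃ * s₃) ≈ 0#
        w⊥s = three-terms (sin ∘ θ) w⊥sin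

        -- Eliminates w₃: subtract c₃ times the relation with the sines from s₃ times the one with
        -- the cosines. `span₃` eliminates w₂ in the same way.
        span₂ : v * sin (θ e₃ - θ e₂) * w₂ ≈ w₁ * hat θ X e₂
        span₂ = begin
          v * sin (θ e₃ - θ e₂) * w₂
            ≈⟨ *-congʳ (*-congˡ (sin-difference _ _)) ⟩
          v * (s₃ * c₂ - c₃ * s₂) * w₂
            ≈⟨ solve 10 (λ v c₁ s₁ c₂ s₂ c₃ s₃ w₁ w₂ w₃ → v :* (s₃ :* c₂ :- c₃ :* s₂) :* w₂ :=
                 (w₁ :* (:- v :* (s₃ :* c₁ :- c₃ :* s₁)) :+ v :* s₃ :* (w₁ :* c₁ :+ (w₂ :* c₂ :+ w₃ :* c₃))) :-
                 v :* c₃ :* (w₁ :* s₁ :+ (w₂ :* s₂ :+ w₃ :* s₃))) refl v c₁ s₁ c₂ s₂ c₃ s₃ w₁ w₂ w₃ ⟩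
          (w₁ * (- v * (s₃ * c₁ - c₃ * s₁)) + v * s₃ * (w₁ * c₁ + (w₂ * c₂ + w₃ * c₃))) -
            v * c₃ * (w₁ * s₁ + (w₂ * s₂ + w₃ * s₃))
            ≈⟨ drop-zeros w⊥c w⊥s ⟩
          w₁ * (- v * (s₃ * c₁ - c₃ * s₁))
            ≈⟨ *-congˡ (trans (*-congˡ (sym (sin-difference _ _))) (sym hat₂)) ⟩
          w₁ * hat θ X e₂ ∎

        span₃ : v * sin (θ e₃ - θ e₂) * w₃ ≈ w₁ * hat θ X e₃
        span₃ = begin
          v * sin (θ e₃ - θ e₂) * w₃
            ≈⟨ *-congʳ (*-congˡ (sin-difference _ _)) ⟩
          v * (s₃ * c₂ - c₃ * s₂) * w₃
            ≈⟨ solve 10 (λ v c₁ s₁ c₂ s₂ c₃ s₃ w₁ w₂ w₃ → v :* (s₃ :* c₂ :- c₃ :* s₂) :* w₃ :=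
                 (w₁ :* (v :* (s₂ :* c₁ :- c₂ :* s₁)) :+ v :* c₂ :* (w₁ :* s₁ :+ (w₂ :* s₂ :+ w₃ :* s₃))) :-
                 v :* s₂ :* (w₁ :* c₁ :+ (w₂ :* c₂ :+ w₃ :* c₃))) refl v c₁ s₁ c₂ s₂ c₃ s₃ w₁ w₂ w₃ ⟩
          (w₁ * (v * (s₂ * c₁ - c₂ * s₁)) + v * c₂ * (w₁ * s₁ + (w₂ * s₂ + w₃ * s₃))) -
            v * s₂ * (w₁ * c₁ + (w₂ * c₂ + w₃ * c₃))
            ≈⟨ drop-zeros w⊥s w⊥c ⟩
          w₁ * (v * (s₂ * c₁ - c₂ * s₁))
            ≈⟨ *-congˡ (trans (*-congˡ (sym (sin-difference _ _))) (sym hat₃)) ⟩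
          w₁ * hat θ X e₃ ∎

      -- Proportionality of `w` and `hat θ X` with denominators cleared: the factor on the left is
      -- the entry of `hat θ X` at `e₁`.
      hat-span : ∀ e → v * sin (θ e₃ - θ e₂) * w e ≈ w e₁ * hat θ X e
      hat-span e with e ≟ e₁ | e ≟ e₂ | e ≟ e₃
      ... | yes ≡.refl | _          | _          = trans (*-comm _ _) (*-congˡ (sym hat₁))
      ... | no _       | yes ≡.refl | _          = span₂
      ... | no _       | no _       | yes ≡.refl = span₃
      ... | no p       | no q       | no r       = trans (*-congˡ (w≈0 e p q r)) (trans (zeroʳ _)
              (sym (trans (*-congˡ (hat≈0 e p q r)) (zeroʳ _))))

  ΣT-kernel : ∀ θ i → ∑ (λ e → ΣT θ i e * cos (θ e)) ≈ 0# × ∑ (λ e → ΣT θ i e * sin (θ e)) ≈ 0#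
  ΣT-kernel θ i with circuit-chain (a i) (A⊆𝒞≺ i)
  ... | s , e₁ , e₂ , e₃ , e₁≺e₂ , e₂≺e₃ , pat =
    hat-kernel cos (proj₁ (sine-relation (θ e₁) (θ e₂) (θ e₃))) , hat-kernel sin (proj₂ (sine-relation (θ e₁) (θ e₂) (θ e₃)))
    where open Chain θ (a i) e₁≺e₂ e₂≺e₃ pat

  ·1-mono : ∀ {i j} → i ℕ.< j → i · 1# < j · 1#
  ·1-mono {zero}  {suc j} (s≤s _)   = natural-pos j
  ·1-mono {suc i} {suc j} (s≤s i<j) = <-resp (+-comm _ _) (+-comm _ _) (+-monoˡ-< 1# (·1-mono i<j))

  -- The angle of `e` is `suc (rank e)` steps of size 180/(m+2): `suc` keeps it positive, and since
  -- ranks are at most m it stays below m+2 steps.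
  respecting : ∃ Respects
  respecting = θ , (λ e → *-pos (natural-pos (rank e)) 0<d , <-respʳ-≈ (trans Nd≈π π≈180) (*-monoʳ (·1-mono (s≤s (s≤s (rank≤m e)))))) ,
    λ e f e≺f → *-monoʳ (·1-mono (s≤s (rank-mono e≺f)))
    where
    N = suc (suc m) · 1#
    0<N : 0# < N
    0<N = natural-pos (suc m)
    N⁻¹ = proj₁ (inverse N (>⇒≉0 0<N))
    NN⁻¹≈1 : N * N⁻¹ ≈ 1#
    NN⁻¹≈1 = proj₂ (inverse N (>⇒≉0 0<N))
    d = N⁻¹ * π
    0<d : 0# < d
    0<d = *-pos (*-cancel-pos 0<N (<-respʳ-≈ (sym NN⁻¹≈1) 0<1)) 0<π
    Nd≈π : N * d ≈ π
    Nd≈π = trans (sym (*-assoc _ _ _)) (trans (*-congʳ NN⁻¹≈1) (*-identityˡ π))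
    θ : Fin m → Carrier
    θ e = suc (rank e) · 1# * d
    *-monoʳ : ∀ {x y} → x < y → x * d < y * d
    *-monoʳ {x} {y} x<y = 0<⇒< (<-respʳ-≈ (solve 3 (λ x y d → (y :- x) :* d := y :* d :- x :* d) refl x y d) (*-pos (<⇒0< x<y) 0<d))

  -- The ends t = 0 and t = 1 are separated off because there one summand of (1 - t)x + ty vanishes.
  convex-pos : ∀ {x y t} → 0# < x → 0# < y → ¬ t < 0# → ¬ 1# < t → 0# < x + t * (y - x)
  convex-pos {x} {y} {t} 0<x 0<y 0≤t t≤1 with compare t 0# | compare t 1#
  ... | tri< lt _ _ | _ = ⊥-elim (0≤t lt)
  ... | _ | tri> _ _ gt = ⊥-elim (t≤1 gt)
  ... | tri≈ _ t≈0 _ | _ = <-respʳ-≈ (sym (trans (+-congˡ (trans (*-congʳ t≈0) (zeroˡ _))) (+-identityʳ x))) 0<x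
  ... | tri> _ _ 0<t | tri≈ _ t≈1 _ = <-respʳ-≈ (trans (solve 2 (λ x y → y := x :+ # 1 :* (y :- x)) refl x y) (+-congˡ (*-congʳ (sym t≈1)))) 0<y
  ... | tri> _ _ 0<t | tri< t<1 _ _ = <-respʳ-≈ (solve 3 (λ x y t → (# 1 :- t) :* x :+ t :* y := x :+ t :* (y :- x)) refl x y t)
          (+-pos (*-pos (<⇒0< t<1) 0<x) (*-pos 0<t 0<y))

  convex-< : ∀ {x y z u t} → x < z → y < u → ¬ t < 0# → ¬ 1# < t → x + t * (y - x) < z + t * (u - z)
  convex-< {x} {y} {z} {u} {t} x<z y<u 0≤t t≤1 = 0<⇒< (<-respʳ-≈
    (solve 5 (λ x y z u t → (z :- x) :+ t :* ((u :- y) :- (z :- x)) := (z :+ t :* (u :- z)) :- (x :+ t :* (y :- x))) refl x y z u t)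
    (convex-pos (<⇒0< x<z) (<⇒0< y<u) 0≤t t≤1))

  segment : (θ₀ θ₁ : Fin m → Carrier) → Carrier → Fin m → Carrier
  segment θ₀ θ₁ t e = θ₀ e + t * (θ₁ e - θ₀ e)

  segment-respects : ∀ {θ₀ θ₁ t} → Respects θ₀ → Respects θ₁ → ¬ t < 0# → ¬ 1# < t → Respects (segment θ₀ θ₁ t)
  segment-respects {θ₀} {θ₁} {t} (range₀ , mono₀) (range₁ , mono₁) 0≤t t≤1 =
    (λ e → convex-pos (proj₁ (range₀ e)) (proj₁ (range₁ e)) 0≤t t≤1 ,
      <-respʳ-≈ (constant _) (convex-< (proj₂ (range₀ e)) (proj₂ (range₁ e)) 0≤t t≤1)) ,
    λ e f e≺f → convex-< (mono₀ e f e≺f) (mono₁ e f e≺f) 0≤t t≤1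
    where
    constant : ∀ x → x + t * (x - x) ≈ x
    constant x = solve 2 (λ x t → x :+ t :* (x :- x) := x) refl x t

  -- The result of `otherTwo?` does not depend on the angles, so along a segment an entry is either
  -- constantly 0 or a constant times one sine of an affine function of `t`.
  continuous-hat : ∀ θ₀ θ₁ X e → Continuous (λ t → hat (segment θ₀ θ₁ t) X e)
  continuous-hat θ₀ θ₁ X e with otherTwo? X e
  ... | no _ = continuous-const 0#
  ... | yes (f , g , _) = continuous-* (continuous-const _) (continuous-cong
          (λ t → sin-cong (solve 5 (λ x y z w t → (z :- x) :+ t :* ((w :- z) :- (y :- x)) := (z :+ t :* (w :- z)) :- (x :+ t :* (y :- x)))
            refl (θ₀ f) (θ₁ f) (θ₀ g) (θ₁ g) t))
          (continuous-sin-affine (θ₀ g - θ₀ f) ((θ₁ g - θ₀ g) - (θ₁ f - θ₀ f))))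

  hasSign⇒pos : ∀ {x} s → HasSign x s → 0# < value (just s) * x
  hasSign⇒pos {x} Sign.+ 0<x = <-respʳ-≈ (sym (*-identityˡ x)) 0<x
  hasSign⇒pos {x} Sign.- x<0 = <-respʳ-≈ (solve 1 (λ x → :- x := :- # 1 :* x) refl x) (neg-pos x<0)

  pos⇒hasSign : ∀ {x} s → 0# < value (just s) * x → HasSign x s
  pos⇒hasSign {x} Sign.+ 0<x = <-respʳ-≈ (*-identityˡ x) 0<x
  pos⇒hasSign {x} Sign.- 0<-x = <-respˡ-≈ (solve 1 (λ x → :- (:- # 1 :* x) := x) refl x) (neg-neg 0<-x)

  value-* : ∀ s t → value (just (s Sign.* t)) ≈ value (just s) * value (just t)
  value-* Sign.+ t = sym (*-identityˡ _)
  value-* Sign.- t = trans (value-opposite t) (solve 1 (λ x → :- x := :- # 1 :* x) refl (value (just t)))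

  signOf : ∀ {x} → ¬ x ≈ 0# → ∃[ s ] HasSign x s
  signOf {x} x≉0 with compare x 0#
  ... | tri< lt _ _ = Sign.- , lt
  ... | tri≈ _ eq _ = ⊥-elim (x≉0 eq)
  ... | tri> _ _ gt = Sign.+ , gt

-- Solubility and the determinant

module Simplicial {c ℓ₁ ℓ₂} {ℝ : Reals c ℓ₁ ℓ₂} (trig : Trigonometry ℝ)
                  {n m q : ℕ} (T : TwistedGraph n m (suc q)) where
  open Reals ℝ renaming (zero to *-zero)
  open Trigonometry trig using (sin; cos; sin-pos)
  open OrderedField ℝ
  open Determinants ℝ
  open Continuity ℝ
  open Sums ℝ
  open TwistedMatrix trig T
  open import Relation.Binary.Reasoning.Setoid setoid
  open TwistedGraph T
  open Linear ℝ
  open Twisted trig T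

  module OnSubset
      (F : Subset m) (f : Fin q → Fin m) (f-enum : Enumerates f F)
      (simplex : ∀ θ → Respects θ → IsSimplex (columns (ΣT θ) f))
      (x₁ x₂ x₃ : Fin m) (x₁≺x₂ : x₁ ≺ x₂) (x₂≺x₃ : x₂ ≺ x₃)
      (F≡ : F ≡ ∁ (⁅ x₁ ⁆ ∪ (⁅ x₂ ⁆ ∪ ⁅ x₃ ⁆)))
      (cols : Fin (suc q) → Fin m) (cols-enum : Enumerates cols (F ∪ ⁅ x₁ ⁆)) where

    ∉F⇒ : ∀ {e} → e ∉ F → e ≡ x₁ ⊎ e ≡ x₂ ⊎ e ≡ x₃
    ∉F⇒ {e} e∉F = ∈-triple⁻ (x∉∁p⇒x∈p (≡.subst (e ∉_) F≡ e∉F))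

    x₁∉F : x₁ ∉ F
    x₁∉F x₁∈F = x∈p⇒x∉∁p (∈-triple⁺ (inj₁ ≡.refl)) (≡.subst (x₁ ∈_) F≡ x₁∈F)

    k∃ : ∃[ k ] cols k ≡ x₁
    k∃ = Equivalence.to (proj₂ cols-enum x₁) (x∈p∪q⁺ (inj₂ (x∈⁅x⁆ x₁)))

    k : Fin (suc q)
    k = proj₁ k∃

    cols∈F : ∀ {j} → j ≢ k → cols j ∈ F
    cols∈F {j} j≢k with x∈p∪q⁻ F ⁅ x₁ ⁆ (Equivalence.from (proj₂ cols-enum (cols j)) (j , ≡.refl))
    ... | inj₁ ∈F  = ∈F
    ... | inj₂ ∈x₁ = ⊥-elim (j≢k (proj₁ cols-enum (≡.trans (x∈⁅y⁆⇒x≡y x₁ ∈x₁) (≡.sym (proj₂ k∃)))))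

    F⇒cols : ∀ {e} → e ∈ F → ∃[ l ] cols (punchIn k l) ≡ e
    F⇒cols {e} e∈F with Equivalence.to (proj₂ cols-enum e) (x∈p∪q⁺ (inj₁ e∈F))
    ... | j , ≡.refl with k ≟ j
    ... | yes ≡.refl = ⊥-elim (x₁∉F (≡.subst (_∈ F) (proj₂ k∃) e∈F))
    ... | no k≢j = punchOut k≢j , ≡.cong cols (punchIn-punchOut k≢j)

    -- F is enumerated both by `f` and by `cols` with position `k` removed; this form of a
    -- dependency refers to neither.
    VanishesOnF : (Fin m → Carrier) → (Fin (suc q) → Carrier) → Set ℓ₁
    VanishesOnF θ ν = ∀ {e} → e ∈ F → ∑ (λ i → ν i * ΣT θ i e) ≈ 0#

    vanishes⇒dependency : ∀ θ ν → VanishesOnF θ ν → RowDependency (columns (ΣT θ) f) ν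
    vanishes⇒dependency θ ν ν≈0 j = trans (sym (∑≈sum _)) (ν≈0 (Equivalence.from (proj₂ f-enum (f j)) (j , ≡.refl)))

    dependency⇒vanishes : ∀ θ ν → RowDependency (columns (ΣT θ) f) ν → VanishesOnF θ ν
    dependency⇒vanishes θ ν dep {e} e∈F with Equivalence.to (proj₂ f-enum e) e∈F
    ... | j , ≡.refl = trans (∑≈sum _) (dep j)

    minor : (Fin m → Carrier) → Carrier
    minor θ = det λ i l → ΣT θ (suc i) (cols (punchIn k l))

    -- The cofactor of the entry in row `zero` and column x₁ of `columns (ΣT θ) cols`.
    E : (Fin m → Carrier) → Carrier
    E θ = ε k * minor θ

    module _ (θ : Fin m → Carrier) (resp : Respects θ) where
      private
        μ = proj₁ (proj₂ (simplex θ resp))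
        μ>0 : ∀ i → 0# < μ i
        μ>0 = proj₁ (proj₂ (proj₂ (simplex θ resp)))
        μ-vanishes : VanishesOnF θ μ
        μ-vanishes = dependency⇒vanishes θ μ (proj₁ (proj₂ (proj₂ (proj₂ (simplex θ resp)))))
        multiple : ∀ ν → VanishesOnF θ ν → ∃[ t ] (∀ i → ν i ≈ t * μ i)
        multiple ν ν≈0 = proj₂ (proj₂ (proj₂ (proj₂ (simplex θ resp)))) ν (vanishes⇒dependency θ ν ν≈0)

      -- A dependency of the rows other than `zero`, extended by coefficient 0, would be t μ; as
      -- `μ zero` is positive, t = 0.
      E≉0 : ¬ E θ ≈ 0#
      E≉0 with singular-or-regular (λ i l → ΣT θ (suc i) (cols (punchIn k l)))
      ... | inj₂ (minor≉0 , _) = *-≉0 (ε≉0 k) minor≉0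
      ... | inj₁ (ν , (i , νᵢ≉0) , dep) with multiple (0# ∷ ν) vanishes
        where
        vanishes : VanishesOnF θ (0# ∷ ν)
        vanishes e∈F with F⇒cols e∈F
        ... | l , ≡.refl = trans (∑-suc _) (trans (+-cong (zeroˡ _) (dep l)) (+-identityˡ 0#))
      ...   | t , ν≈tμ = ⊥-elim (νᵢ≉0 (trans (ν≈tμ (suc i)) (trans (*-congʳ t≈0) (zeroˡ _))))
        where
        t≈0 : t ≈ 0#
        t≈0 = *-cancel-0 (>⇒≉0 (μ>0 zero)) (trans (*-comm _ _) (sym (ν≈tμ zero)))

      w : Fin m → Carrier
      w e = ∑ (λ i → μ i * ΣT θ i e)

      w-off : ∀ e → e ≢ x₁ → e ≢ x₂ → e ≢ x₃ → w e ≈ 0#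
      w-off e ≢₁ ≢₂ ≢₃ with e ∈? F
      ... | yes e∈F = μ-vanishes e∈F
      ... | no  e∉F = ⊥-elim ([ ≢₁ , [ ≢₂ , ≢₃ ]′ ]′ (∉F⇒ e∉F))

      w-kernel : ∀ g → (∀ i → ∑ (λ e → ΣT θ i e * g e) ≈ 0#) → ∑ (λ e → w e * g e) ≈ 0#
      w-kernel g g⊥ = trans (∑-∑-* μ (ΣT θ) g) (∑-zero λ i → trans (*-congˡ (g⊥ i)) (zeroʳ _))

      det-w : μ zero * det (columns (ΣT θ) cols) ≈ E θ * w x₁
      det-w = begin
        μ zero * det M
          ≈⟨ det-combination μ M ⟨
        det ((w ∘ cols) ∷ (M ∘ suc))
          ≈⟨ det-single-row (w ∘ cols) (M ∘ suc) k (λ l l≢k → μ-vanishes (cols∈F l≢k)) ⟩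
        ε k * (w (cols k) * minor θ)
          ≈⟨ *-congˡ (*-congʳ (reflexive (≡.cong w (proj₂ k∃)))) ⟩
        ε k * (w x₁ * minor θ)
          ≈⟨ solve 3 (λ e w n → e :* (w :* n) := e :* n :* w) refl (ε k) (w x₁) (minor θ) ⟩
        E θ * w x₁ ∎
        where
        M : Matrix (suc q) (suc q)
        M = columns (ΣT θ) cols

      -- A dependency on all of `cols` is in particular one on F, hence t μ; at x₁ it gives t w(x₁)
      -- = 0, so t = 0.
      right-inverse : ¬ w x₁ ≈ 0# → Σ[ r ∈ Vector Carrier m ] (∀ i → ∑ (λ e → ΣT θ i e * r e) ≈ 1#)
      right-inverse w≉0 with singular-or-regular (columns (ΣT θ) cols)
      ... | inj₁ (ν , (i , νᵢ≉0) , dep) with multiple ν vanishes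
        where
        vanishes : VanishesOnF θ ν
        vanishes e∈F with F⇒cols e∈F
        ... | l , ≡.refl = dep (punchIn k l)
      ...   | t , ν≈tμ = ⊥-elim (νᵢ≉0 (trans (ν≈tμ i) (trans (*-congʳ t≈0) (zeroˡ _))))
        where
        t≈0 : t ≈ 0#
        t≈0 = *-cancel-0 w≉0 (begin
          w x₁ * t
            ≈⟨ trans (*-comm _ _) (*-distribˡ-∑ t _) ⟩
          ∑ (λ i → t * (μ i * ΣT θ i x₁))
            ≈⟨ ∑-cong (λ i → trans (sym (*-assoc _ _ _)) (*-congʳ (sym (ν≈tμ i)))) ⟩
          ∑ (λ i → ν i * ΣT θ i x₁)
            ≈⟨ ∑-cong (λ i → *-congˡ (reflexive (≡.cong (ΣT θ i) (≡.sym (proj₂ k∃))))) ⟩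
          ∑ (λ i → ν i * ΣT θ i (cols k))
            ≈⟨ dep k ⟩
          0# ∎)
      right-inverse w≉0 | inj₂ (_ , solution) with solution (λ _ → 1#)
      -- Extension by zero, written as a sum over positions so that `cols` need not be inverted.
      ... | r , Mr≈1 = (λ e → ∑ λ j → only (cols j) (λ _ → r j) e) , λ i → begin
        ∑ (λ e → ΣT θ i e * ∑ (λ j → only (cols j) (λ _ → r j) e))
          ≈⟨ ∑-cong (λ e → trans (*-distribˡ-∑ _ _) (∑-cong λ j → *-only (cols j) (ΣT θ i) (λ _ → r j) e)) ⟩
        ∑ (λ e → ∑ λ j → only (cols j) (λ e → ΣT θ i e * r j) e)
          ≈⟨ ∑-comm _ ⟩
        ∑ (λ j → ∑ λ e → only (cols j) (λ e → ΣT θ i e * r j) e)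
          ≈⟨ ∑-cong (λ j → ∑-only (cols j) (λ e → ΣT θ i e * r j)) ⟩
        ∑ (λ j → ΣT θ i (cols j) * r j)
          ≈⟨ Mr≈1 i ⟩
        1# ∎

      S₂₃>0 : 0# < sin (θ x₃ - θ x₂)
      S₂₃>0 = sin-pos _ (<⇒0< (proj₂ resp x₂ x₃ x₂≺x₃)) (<-trans (0<⇒< (<-respʳ-≈
        (solve 2 (λ x y → x := y :- (y :- x)) refl (θ x₂) (θ x₃)) (proj₁ (proj₁ resp x₂)))) (proj₂ (proj₁ resp x₃)))

      module _ (C : SignedSet m) {s} (pat : SignPattern C s x₁ x₂ x₃) where
        private v = value (just s)

        w-hat : ∀ (r : Vector Carrier m) → v * sin (θ x₃ - θ x₂) * ∑ (λ e → w e * r e) ≈ w x₁ * ∑ (λ e → hat θ C e * r e)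
        w-hat r = begin
          v * sin (θ x₃ - θ x₂) * ∑ (λ e → w e * r e)
            ≈⟨ *-distribˡ-∑ _ _ ⟩
          ∑ (λ e → v * sin (θ x₃ - θ x₂) * (w e * r e))
            ≈⟨ ∑-cong (λ e → trans (sym (*-assoc _ _ _)) (trans (*-congʳ (span e)) (*-assoc _ _ _))) ⟩
          ∑ (λ e → w x₁ * (hat θ C e * r e))
            ≈⟨ *-distribˡ-∑ _ _ ⟨
          w x₁ * ∑ (λ e → hat θ C e * r e) ∎
          where
          span : ∀ e → v * sin (θ x₃ - θ x₂) * w e ≈ w x₁ * hat θ C e
          span = Chain.hat-span θ C x₁≺x₂ x₂≺x₃ pat w w-off
            (w-kernel _ λ i → proj₁ (ΣT-kernel θ i)) (w-kernel _ λ i → proj₂ (ΣT-kernel θ i))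

        -- As v² = 1, the factor v of w-hat can be moved to the other side.
        w-hat′ : ∀ (r : Vector Carrier m) → sin (θ x₃ - θ x₂) * ∑ (λ e → w e * r e) ≈ (v * w x₁) * ∑ (λ e → hat θ C e * r e)
        w-hat′ r = begin
          S * y                  ≈⟨ *-identityˡ _ ⟨
          1# * (S * y)           ≈⟨ *-congʳ (value² s) ⟨
          v * v * (S * y)        ≈⟨ solve 3 (λ v s y → v :* v :* (s :* y) := v :* (v :* s :* y)) refl v S y ⟩
          v * (v * S * y)        ≈⟨ *-congˡ (w-hat r) ⟩
          v * (w x₁ * h)         ≈⟨ *-assoc _ _ _ ⟨
          (v * w x₁) * h         ∎
          where
          S = sin (θ x₃ - θ x₂)
          y = ∑ (λ e → w e * r e)
          h = ∑ (λ e → hat θ C e * r e)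

        -- `v * w x₁` has the sign of the factor between `w` and `hat θ C`, because the entry of
        -- `hat θ C` at x₁ is `v` times a positive sine.
        soluble⇒ : Soluble θ C → 0# < v * w x₁
        soluble⇒ (r , ΣTr>0 , Cr>0) = *-cancel-pos (<-respʳ-≈ (sym (∑≈sum _)) Cr>0)
          (<-respʳ-≈ (trans (w-hat′ r) (*-comm _ _)) (*-pos S₂₃>0
            (<-respʳ-≈ (sym (∑-∑-* μ (ΣT θ) r)) (∑-pos _ λ i → *-pos (μ>0 i) (<-respʳ-≈ (sym (∑≈sum _)) (ΣTr>0 i))))))

        ⇒soluble : 0# < v * w x₁ → Soluble θ C
        ⇒soluble vw>0 with right-inverse (λ w≈0 → >⇒≉0 vw>0 (trans (*-congˡ w≈0) (zeroʳ v)))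
        ... | r , ΣTr≈1 = r , (λ i → <-respʳ-≈ (trans (sym (ΣTr≈1 i)) (∑≈sum _)) 0<1) ,
          <-respʳ-≈ (∑≈sum _) (*-cancel-pos vw>0 (<-respʳ-≈ (w-hat′ r) (*-pos S₂₃>0
            (<-respʳ-≈ (sym (∑-∑-* μ (ΣT θ) r)) (∑-pos _ λ i → *-pos (μ>0 i) (<-respʳ-≈ (sym (ΣTr≈1 i)) 0<1))))))

        module _ (τ : Sign) (E-sign : HasSign (E θ) τ) where
          private
            D = det (columns (ΣT θ) cols)
            u = value (just τ)
            -- Both `μ zero` and `u * E θ` are positive, so the other two factors have the same
            -- sign; this carries the criterion on `v * w x₁` over to the determinant.
            identity : μ zero * (value (just (s Sign.* τ)) * D) ≈ (u * E θ) * (v * w x₁)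
            identity = begin
              μ zero * (value (just (s Sign.* τ)) * D)
                ≈⟨ *-congˡ (*-congʳ (value-* s τ)) ⟩
              μ zero * (v * u * D)
                ≈⟨ solve 4 (λ μ v u d → μ :* (v :* u :* d) := v :* u :* (μ :* d)) refl (μ zero) v u D ⟩
              v * u * (μ zero * D)
                ≈⟨ *-congˡ det-w ⟩
              v * u * (E θ * w x₁)
                ≈⟨ solve 4 (λ v u e w → v :* u :* (e :* w) := (u :* e) :* (v :* w)) refl v u (E θ) (w x₁) ⟩
              (u * E θ) * (v * w x₁) ∎

          soluble⇔ : Soluble θ C ⇔ HasSign D (s Sign.* τ)
          soluble⇔ = mk⇔
            (λ soluble → pos⇒hasSign (s Sign.* τ) (*-cancel-pos (μ>0 zero)
              (<-respʳ-≈ (sym identity) (*-pos (hasSign⇒pos τ E-sign) (soluble⇒ soluble)))))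
            (λ D-sign → ⇒soluble (*-cancel-pos (hasSign⇒pos τ E-sign)
              (<-respʳ-≈ identity (*-pos (μ>0 zero) (hasSign⇒pos (s Sign.* τ) D-sign)))))

    E-cong : ∀ {θ θ′} → (∀ e → θ e ≈ θ′ e) → E θ ≈ E θ′
    E-cong θ≈θ′ = *-congˡ (det-cong _ _ λ i l → hat-cong (a (suc i)) _ θ≈θ′)

    E-sign-constant : ∀ {θ₀ θ₁} → Respects θ₀ → Respects θ₁ → ∀ τ → HasSign (E θ₀) τ → HasSign (E θ₁) τ
    E-sign-constant {θ₀} {θ₁} resp₀ resp₁ τ E₀ = transport τ (E-cong at-1)
      (sign-constant along-cong (continuous-* (continuous-const (ε k)) (continuous-det _ λ i l → continuous-hat θ₀ θ₁ (a (suc i)) _))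
        (λ t 0≤t t≤1 → E≉0 (segment θ₀ θ₁ t) (segment-respects resp₀ resp₁ 0≤t t≤1)) τ
        (transport τ (E-cong (λ e → sym (at-0 e))) E₀))
      where
      transport : ∀ {x y} τ → x ≈ y → HasSign x τ → HasSign y τ
      transport Sign.+ = <-respʳ-≈
      transport Sign.- = <-respˡ-≈
      at-0 : ∀ e → segment θ₀ θ₁ 0# e ≈ θ₀ e
      at-0 e = solve 2 (λ x y → x :+ # 0 :* (y :- x) := x) refl (θ₀ e) (θ₁ e)
      at-1 : ∀ e → segment θ₀ θ₁ 1# e ≈ θ₁ e
      at-1 e = solve 2 (λ x y → x :+ # 1 :* (y :- x) := y) refl (θ₀ e) (θ₁ e)
      along-cong : ∀ {t t′} → t ≈ t′ → E (segment θ₀ θ₁ t) ≈ E (segment θ₀ θ₁ t′)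
      along-cong t≈t′ = E-cong λ e → +-congˡ (*-congʳ t≈t′)

    private
      θ₀ = proj₁ respecting
      resp₀ = proj₂ respecting
      τ₀ = proj₁ (signOf (E≉0 θ₀ resp₀))

    -- The default `Sign.+` only makes σ total: an alternating `C` is nonzero at x₁. Since `τ₀` is
    -- taken at a fixed base point, σ does not depend on θ.
    σ : SignedSet m → Sign
    σ C = fromMaybe Sign.+ (lookup C x₁) Sign.* τ₀

    opposite-* : ∀ s t → opposite s Sign.* t ≡ opposite (s Sign.* t)
    opposite-* Sign.+ t = ≡.refl
    opposite-* Sign.- Sign.+ = ≡.refl
    opposite-* Sign.- Sign.- = ≡.refl

    σ-correct : ∀ C → Alternating x₁ x₂ x₃ C →
      (∀ θ → Respects θ → (Soluble θ C ⇔ HasSign (det (columns (ΣT θ) cols)) (σ C))) × σ (-ˢ C) ≡ opposite (σ C)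
    σ-correct C alt =
      (λ θ resp → ≡.subst (λ t → Soluble θ C ⇔ HasSign (det (columns (ΣT θ) cols)) t) (≡.sym σC)
        (soluble⇔ θ resp C pat τ₀ (E-sign-constant resp₀ resp τ₀ (proj₂ (signOf (E≉0 θ₀ resp₀)))))) ,
      ≡.trans σ-C (≡.trans (opposite-* s τ₀) (≡.cong opposite (≡.sym σC)))
      where
      s : Sign
      s = proj₁ (alternating⇒pattern C alt)
      pat : SignPattern C s x₁ x₂ x₃
      pat = proj₂ (alternating⇒pattern C alt)
      σC : σ C ≡ s Sign.* τ₀
      σC = ≡.cong (λ x → fromMaybe Sign.+ x Sign.* τ₀) (proj₁ pat)
      σ-C : σ (-ˢ C) ≡ opposite s Sign.* τ₀
      σ-C = ≡.cong (λ x → fromMaybe Sign.+ x Sign.* τ₀)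
        (≡.trans (lookup-map x₁ (Maybe.map opposite) C) (≡.cong (Maybe.map opposite) (proj₁ pat)))

theoremt :
  ∀ {c ℓ₁ ℓ₂ : Level} (ℝ : Reals c ℓ₁ ℓ₂) (trig : Trigonometry ℝ)
    {n m p : ℕ} (T : TwistedGraph n m p) →
  let open TwistedGraph T
      open Linear ℝ
      open Twisted trig T
  in (F : Subset m) → SimplicialOn F →
     (x₁ x₂ x₃ : Fin m) → x₁ ≺ x₂ → x₂ ≺ x₃ →
     F ≡ ∁ (⁅ x₁ ⁆ ∪ (⁅ x₂ ⁆ ∪ ⁅ x₃ ⁆)) →
     (cols : Fin p → Fin m) → Enumerates cols (F ∪ ⁅ x₁ ⁆) →
     Σ[ σ ∈ (SignedSet m → Sign) ]
       (∀ C → Alternating x₁ x₂ x₃ C →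
         (∀ θ → Respects θ →
           (Soluble θ C ⇔ HasSign (det (columns (ΣT θ) cols)) (σ C)))
         × σ (-ˢ C) ≡ opposite (σ C))
theoremt ℝ trig {m = m} T F (q , f , f-enum , simplex) x₁ x₂ x₃ x₁≺x₂ x₂≺x₃ F≡ cols cols-enum =
  -- The equation p ≡ suc q is part of the simplex property at a particular θ, here the one from
  -- `respecting`. `fromSize` generalises over the size so that it can be matched with `refl`.
  fromSize (proj₁ (uncurry simplex (TwistedMatrix.respecting trig T))) T f-enum simplex x₁≺x₂ x₂≺x₃ cols-enum
  where
  open Linear ℝ
  fromSize : ∀ {n p} → p ≡ suc q → (T : TwistedGraph n m p) →
    let open TwistedGraph T
        open Twisted trig T
    in Enumerates f F → (∀ θ → Respects θ → IsSimplex (columns (ΣT θ) f)) → x₁ ≺ x₂ → x₂ ≺ x₃ →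
       {cols : Fin p → Fin m} → Enumerates cols (F ∪ ⁅ x₁ ⁆) →
       Σ[ σ ∈ (SignedSet m → Sign) ]
         (∀ C → Alternating x₁ x₂ x₃ C →
           (∀ θ → Respects θ →
             (Soluble θ C ⇔ HasSign (det (columns (ΣT θ) cols)) (σ C)))
           × σ (-ˢ C) ≡ opposite (σ C))
  fromSize ≡.refl T f-enum simplex x₁≺x₂ x₂≺x₃ {cols} cols-enum = σ , σ-correct
    where
    open Simplicial.OnSubset trig T F f f-enum simplex x₁ x₂ x₃ x₁≺x₂ x₂≺x₃ F≡ cols cols-enum
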